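{- Let $G$ be a connected graph and $E^*$ a set of edges of $G$. Suppose that (i) $r_0=\ell_G(E^*)$ is even; and (ii) there is a way to assign an orientation $\overrightarrow{e}$ to each edge $e\in E^*$ such that the directed edges in $\overrightarrow{E^*}=\{\overrightarrow{e}:e\in E^*\}$ are balanced on every cycle $C$ of $G$ with $|E(C)|<r_0$. Then $G$ belongs to $DP_<$.
   Context: All graphs are finite and simple. For a graph $G$ and $m\in\mathbb{N}$, a cover of $G$ is a pair $\mathcal{H}=(L,H)$ where $H$ is a graph and $L$ maps each vertex of $G$ to a subset of $V(H)$ such that: $\{L(u):u\in V(G)\}$ partitions $V(H)$; each $H[L(u)]$ is complete; if $u,v$ are non-adjacent in $G$ there are no edges of $H$ between $L(u)$ and $L(v)$; for each edge $uv\in E(G)$ the edges of $H$ between $L(u)$ and $L(v)$ form a matching. It is $m$-fold if $|L(v)|=m$ for all $v$. An $\mathcal{H}$-coloring is an independent set of $H$ of size $|V(G)|$; $P_{DP}(G,\mathcal{H})$ is their number, and the DP color function $P_{DP}(G,m)$ is the minimum of $P_{DP}(G,\mathcal{H})$ over all $m$-fold covers $\mathcal{H}$ of $G$. $P(G,m)$ is the chromatic polynomial. $DP_<$ is the set of graphs $G$ for which there is an integer $M$ with $P_{DP}(G,m)<P(G,m)$ for all integers $m\ge M$. For $E_0\subseteq E(G)$, the girth $\ell_G(E_0)$ is the minimum length of a cycle $C$ in $G$ with $|E(C)\cap E_0|$ odd, and $\ell_G(E_0)=\infty$ if no such cycle exists. Given orientations of the edges of $E^*$ (only edges of $E^*$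 are oriented), the directed edges of $\overrightarrow{E^*}$ are balanced on a cycle $C$ if $|E(C)\cap E^*|$ is even and exactly half of the edges in $E(C)\cap E^*$ are oriented in the same direction as a fixed traversal direction of $C$ (e.g. clockwise); otherwise they are unbalanced on $C$. (In particular they are balanced on $C$ if $E(C)\cap E^*=\emptyset$.) -}

module Defs where

open import Data.Nat using (ℕ; zero; suc; _+_; _*_; _≤_; _<_; _%_)
open import Data.Nat.DivMod using (m%n<n)
open import Data.Fin using (Fin; toℕ; fromℕ<; _≟_)
open import Data.Bool using (Bool; true; false; not; _∧_; _∨_; if_then_else_)
open import Data.Product using (Σ; ∃; _×_; _,_)
open import Data.Vec.Functional using (_∷_)
open import Relation.Nullary.Decidable using (⌊_⌋)
open import Relation.Binary.PropositionalEquality using (_≡_)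
open import Function.Definitions using (Injective)

Even : ℕ → Set
Even r = Σ ℕ λ k → r ≡ k + k

Odd : ℕ → Set
Odd r = Σ ℕ λ k → r ≡ suc (k + k)

sumFin : (k : ℕ) → (Fin k → ℕ) → ℕ
sumFin zero    f = 0
sumFin (suc k) f = f Fin.zero + sumFin k (λ i → f (Fin.suc i))

b2n : Bool → ℕ
b2n true  = 1
b2n false = 0

countFuns : (n m : ℕ) → ((Fin n → Fin m) → Bool) → ℕ
countFuns zero    m p = b2n (p (λ ()))
countFuns (suc n) m p = sumFin m (λ i → countFuns n m (λ f → p (i ∷ f)))

allFin : (k : ℕ) → (Fin k → Bool) → Bool
allFin zero    f = true
allFin (suc k) f = f Fin.zero ∧ allFin k (λ i → f (Fin.suc i))

record Graph : Set where
  field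
    n     : ℕ
    adj   : Fin n → Fin n → Bool
    sym   : ∀ u v → adj u v ≡ adj v u
    irrfl : ∀ u → adj u u ≡ false
open Graph public

data Reach (G : Graph) : Fin (n G) → Fin (n G) → Set where
  here : ∀ {u} → Reach G u u
  step : ∀ {u w v} → adj G u w ≡ true → Reach G w v → Reach G u v

Connected : Graph → Set
Connected G = ∀ u v → Reach G u v

record EdgeSet (G : Graph) : Set where
  field
    mem    : Fin (n G) → Fin (n G) → Bool
    memSym : ∀ u v → mem u v ≡ mem v u
    sub    : ∀ u v → mem u v ≡ true → adj G u v ≡ true
open EdgeSet public

-- orientation of the edges of E₀: dir u v ≡ true means the edge uv is
-- oriented from u to v; for each edge of E₀ exactly one direction is chosen.
record Orientation (G : Graph) (E₀ : EdgeSet G) : Set where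
  field
    dir   : Fin (n G) → Fin (n G) → Bool
    valid : ∀ u v → mem E₀ u v ≡ true → dir u v ≡ not (dir v u)
open Orientation public

-- Cycles: a cycle of length 3 + k is an injective cyclic sequence of
-- vertices vtx 0, …, vtx (k+2) with consecutive ones (cyclically) adjacent.
-- The traversal direction is the direction of increasing index.

next : ∀ {k} → Fin (suc k) → Fin (suc k)
next {k} i = fromℕ< (m%n<n (suc (toℕ i)) (suc k))

record Cycle (G : Graph) : Set where
  field
    k      : ℕ
    vtx    : Fin (3 + k) → Fin (n G)
    inj    : Injective _≡_ _≡_ vtx
    edges  : ∀ i → adj G (vtx i) (vtx (next i)) ≡ true
open Cycle public

cycLength : ∀ {G} → Cycle G → ℕ
cycLength C = 3 + k C

countIn : ∀ {G} → EdgeSet G → Cycle G → ℕ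
countIn E₀ C = sumFin (3 + k C) (λ i → b2n (mem E₀ (vtx C i) (vtx C (next i))))

countForward : ∀ {G} {E₀ : EdgeSet G} → Orientation G E₀ → Cycle G → ℕ
countForward {E₀ = E₀} o C =
  sumFin (3 + k C) (λ i → b2n (mem E₀ (vtx C i) (vtx C (next i))
                               ∧ dir o (vtx C i) (vtx C (next i))))

Balanced : ∀ {G} {E₀ : EdgeSet G} → Orientation G E₀ → Cycle G → Set
Balanced {E₀ = E₀} o C =
  Even (countIn E₀ C) × (countForward o C + countForward o C ≡ countIn E₀ C)

GirthIs : (G : Graph) → EdgeSet G → ℕ → Set
GirthIs G E₀ r =
  (Σ (Cycle G) λ C → Odd (countIn E₀ C) × cycLength C ≡ r)
  × (∀ (C : Cycle G) → Odd (countIn E₀ C) → r ≤ cycLength C)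

properB : (G : Graph) (m : ℕ) → (Fin (n G) → Fin m) → Bool
properB G m f = allFin (n G) λ u → allFin (n G) λ v →
  not (adj G u v ∧ ⌊ f u ≟ f v ⌋)

P : Graph → ℕ → ℕ
P G m = countFuns (n G) m (properB G m)

-- m-fold covers.  WLOG V(H) = V(G) × Fin m with L(u) = {u} × Fin m.
-- H[L(u)] is complete; the cross edges are given by `cross`.

record Cover (G : Graph) (m : ℕ) : Set where
  field
    cross    : Fin (n G) → Fin m → Fin (n G) → Fin m → Bool
    crossSym : ∀ u i v j → cross u i v j ≡ cross v j u i
    crossAdj : ∀ u i v j → cross u i v j ≡ true → adj G u v ≡ true
    matching : ∀ u i v j j′ → cross u i v j ≡ true → cross u i v j′ ≡ true
               → j ≡ j′
open Cover public

Hadj : ∀ {G m} → Cover G m → Fin (n G) × Fin m → Fin (n G) × Fin m → Bool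
Hadj c (u , i) (v , j) =
  (⌊ u ≟ v ⌋ ∧ not ⌊ i ≟ j ⌋) ∨ cross c u i v j

-- An independent set of H of size |V(G)| contains exactly one vertex
-- of each clique L(u), so it is given by a choice f u ∈ L(u) such that
-- {(u , f u)} is independent in H.
isHColoring : ∀ {G m} → Cover G m → (Fin (n G) → Fin m) → Bool
isHColoring {G} c f = allFin (n G) λ u → allFin (n G) λ v →
  ⌊ u ≟ v ⌋ ∨ not (Hadj c (u , f u) (v , f v))

PDPcover : ∀ {G m} → Cover G m → ℕ
PDPcover {G} {m} c = countFuns (n G) m (isHColoring c)

PDPIs : Graph → ℕ → ℕ → Set
PDPIs G m p = (Σ (Cover G m) λ c → PDPcover c ≡ p)
            × (∀ (c : Cover G m) → p ≤ PDPcover c)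

InDPless : Graph → Set
InDPless G = Σ ℕ λ M → ∀ m → M ≤ m → ∀ p → PDPIs G m p → p < P G m

{-# OPTIONS --safe #-}

-- Twist the matching along each edge of E* by a shift of 1 modulo m in the
-- direction of its orientation, and use identity matchings elsewhere.  Expanding
-- both counts by inclusion–exclusion over edge sets A, the difference
-- P(G,m) − P_DP(G,H) is the sum of (−1)^|A| m^c(A) over the A containing a circuit
-- of nonzero total shift: for any other A a gauge transformation identifies the
-- plain and the twisted solutions, and an unbalanced circuit leaves no twisted
-- solution once m exceeds its length.  Such a circuit has length at least r₀, so
-- c(A) ≤ n − r₀ + 1, and equality forces A to be a circuit of length r₀, since a
-- chord would split it into two shorter, hence balanced, circuits.  As r₀ is even,
-- all the leading terms are positive, and there is at least one.
module Submission where

open import Defs hiding (here; step; allFin) renaming (sym to adj-sym)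
import Defs
open import Data.Nat.Base as ℕ using (ℕ; zero; suc; NonZero; _+_; _*_; _∸_; _^_; _≤_; _<_; z≤n; s≤s)
import Data.Nat.Properties as ℕ
import Data.Nat.Divisibility as ℕ
open import Data.Nat.DivMod using (m<n⇒m%n≡m; n%n≡0)
import Data.Nat.Tactic.RingSolver as ℕ-Solver
open import Data.Integer.Base as ℤ using (ℤ; 0ℤ; ∣_∣) renaming (_+_ to _+ᶻ_; -_ to -ᶻ_; +_ to pos)
import Data.Integer.Properties as ℤ
open import Data.Integer.DivMod using (_%ℕ_; _/ℕ_; n%ℕd<d; a≡a%ℕn+[a/ℕn]*n)
open import Data.Integer.Divisibility.Signed using (_∣_; divides; _∣?_; ∣⇒∣ᵤ; ∣m∣n⇒∣m+n; ∣m⇒∣-m)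
open import Data.Integer.Tactic.RingSolver using (solve-∀)
open import Data.Bool.Base using (Bool; true; false; not; _∧_; _∨_)
import Data.Bool.Properties as Bool
open import Data.Bool.ListAction using (all)
open import Data.Fin.Base as Fin using (Fin; zero; suc; toℕ; fromℕ; fromℕ<; inject₁)
import Data.Fin.Properties as Fin
open import Data.Fin.Permutation using (Permutation′; permutation; _⟨$⟩ʳ_)
open import Data.Fin.Relation.Unary.Top using (view; ‵fromℕ; ‵inj₁)
open import Data.Vec.Functional using () renaming (_∷_ to _◂_)
open import Data.List.Base using (List; []; _∷_; [_]; _++_; length; filter; cartesianProduct; tabulate; lookup; allFin)
open import Data.List.Properties using (length-++; ++-assoc; tabulate-lookup; length-tabulate)
open import Data.List.Membership.Propositional using (_∈_; _∉_; find)
open import Data.List.Membership.Propositional.Properties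
  using (∈-++⁻; ∈-++⁺ʳ; ∈-filter⁺; ∈-filter⁻; ∈-cartesianProduct⁺; ∈-allFin; ∈-lookup)
open import Data.List.Membership.Propositional.Properties.WithK using (unique∧set⇒bag)
open import Data.List.Relation.Unary.Any using (here; there)
open import Data.List.Relation.Unary.All as All using (All; []; _∷_)
open import Data.List.Relation.Unary.All.Properties using (¬All⇒Any¬; ¬Any⇒All¬)
open import Data.List.Relation.Unary.AllPairs using ([]; _∷_)
open import Data.List.Relation.Unary.Unique.Propositional using (Unique)
open import Data.List.Relation.Unary.Unique.Propositional.Properties as Unique using (Unique[x∷xs]⇒x∉xs)
open import Data.List.Relation.Binary.BagAndSetEquality using (∼bag⇒↭)
open import Data.List.Relation.Binary.Permutation.Propositional.Properties using (↭-length)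
open import Data.List.Relation.Binary.Sublist.Propositional using (_⊆_; []; _∷_; _∷ʳ_; ⊆-refl)
open import Data.List.Relation.Binary.Sublist.Propositional.Properties using (All-resp-⊆; ++⁺; ++⁺ʳ)
open import Data.Product using (Σ; ∃; _×_; _,_; proj₁; proj₂)
open import Data.Product.Properties using (≡-dec)
open import Data.Sum using (_⊎_; inj₁; inj₂; [_,_]′)
open import Function.Base using (_∘_; id)
open import Function.Bundles using (mk⇔)
open import Relation.Nullary using (¬_; Dec; does; yes; no; contradiction)
open import Relation.Nullary.Decidable using (_×-dec_; ⌊_⌋; does-⇔; dec-true; dec-false)
open import Relation.Binary.Definitions using (tri<; tri≈; tri>)
open import Relation.Binary.PropositionalEquality hiding ([_])
open import Algebra.Properties.CommutativeMonoid.Sum ℕ.+-0-commutativeMonoid as Sum using (sum)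
open import Algebra.Properties.CommutativeSemigroup ℕ.+-commutativeSemigroup using (x∙yz≈y∙xz)

-- Sums over functions

-- Balance is tested on integers. The total shift of a circuit is twice the number of its forward
-- edges in `Es` minus the number of all its edges in `Es`: zero exactly when half of them run
-- forward, and odd, hence nonzero, on the circuit that realises `r₀`. Reduction modulo `m` enters
-- only through the solutions; as each edge shifts by at most 1, `m > n` keeps a nonzero total from
-- vanishing modulo `m`.
--
-- Neither signed sums nor component counts are formed. Inclusion-exclusion runs as a binary
-- recursion in which each edge is dropped or imposed, and it carries inequalities between natural
-- numbers whose sides swap with the parity of the imposed set. Powers of `m` come from exhibiting
-- vertices whose colours are determined by, or may be chosen from, the colours of the others.
--
-- Let `K = m ^ (n ∸ r₀)`. Each of the `2 ^ length edgeList` leaves loses at most `K`, while the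
-- leaf of one fixed circuit of length `r₀` gains at least `m * K`. So `m > 2 ^ length edgeList`
-- decides the comparison.

b2n≤1 : ∀ b → b2n b ≤ 1
b2n≤1 true  = ℕ.≤-refl
b2n≤1 false = z≤n

b2n-mono : ∀ {a b} → (a ≡ true → b ≡ true) → b2n a ≤ b2n b
b2n-mono {false} h = z≤n
b2n-mono {true}  h = ℕ.≤-reflexive (cong b2n (sym (h refl)))

sumFin≡sum : ∀ k (f : Fin k → ℕ) → sumFin k f ≡ sum f
sumFin≡sum zero    f = refl
sumFin≡sum (suc k) f = cong (f zero +_) (sumFin≡sum k (f ∘ suc))

sumFin-cong : ∀ k {f g : Fin k → ℕ} → (∀ i → f i ≡ g i) → sumFin k f ≡ sumFin k g
sumFin-cong zero    f≗g = refl
sumFin-cong (suc k) f≗g = cong₂ _+_ (f≗g zero) (sumFin-cong k (f≗g ∘ suc))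

sumFin-mono : ∀ k {f g : Fin k → ℕ} → (∀ i → f i ≤ g i) → sumFin k f ≤ sumFin k g
sumFin-mono zero    f≤g = z≤n
sumFin-mono (suc k) f≤g = ℕ.+-mono-≤ (f≤g zero) (sumFin-mono k (f≤g ∘ suc))

sumFin-+ : ∀ k (f g : Fin k → ℕ) → sumFin k (λ i → f i + g i) ≡ sumFin k f + sumFin k g
sumFin-+ k f g = begin
  sumFin k (λ i → f i + g i)  ≡⟨ sumFin≡sum k _ ⟩
  sum (λ i → f i + g i)       ≡⟨ Sum.∑-distrib-+ f g ⟩
  sum f + sum g               ≡⟨ cong₂ _+_ (sumFin≡sum k f) (sumFin≡sum k g) ⟨
  sumFin k f + sumFin k g     ∎
  where open ≡-Reasoning

sumFin-const : ∀ k c → sumFin k (λ _ → c) ≡ k * c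
sumFin-const zero    c = refl
sumFin-const (suc k) c = cong (c +_) (sumFin-const k c)

sumFin-zero : ∀ k {f : Fin k → ℕ} → (∀ i → f i ≡ 0) → sumFin k f ≡ 0
sumFin-zero k f≗0 = trans (sumFin-cong k f≗0) (trans (sumFin-const k 0) (ℕ.*-zeroʳ k))

term≤sumFin : ∀ k (f : Fin k → ℕ) i → f i ≤ sumFin k f
term≤sumFin (suc k) f zero    = ℕ.m≤m+n _ _
term≤sumFin (suc k) f (suc i) = ℕ.≤-trans (term≤sumFin k (f ∘ suc) i) (ℕ.m≤n+m _ _)

sumFin-permute : ∀ k (f : Fin k → ℕ) (π : Permutation′ k) → sumFin k (λ i → f (π ⟨$⟩ʳ i)) ≡ sumFin k f
sumFin-permute k f π = begin
  sumFin k (λ i → f (π ⟨$⟩ʳ i))  ≡⟨ sumFin≡sum k _ ⟩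
  sum (λ i → f (π ⟨$⟩ʳ i))       ≡⟨ Sum.sum-permute f π ⟨
  sum f                          ≡⟨ sumFin≡sum k f ⟨
  sumFin k f                     ∎
  where open ≡-Reasoning

sumFin-≤1 : ∀ k (f : Fin k → ℕ) → (∀ i → f i ≤ 1) →
  (∀ i j → f i ≢ 0 → f j ≢ 0 → i ≡ j) → sumFin k f ≤ 1
sumFin-≤1 zero    f f≤1 uniq = z≤n
sumFin-≤1 (suc k) f f≤1 uniq with f zero in eq
... | zero  = sumFin-≤1 k (f ∘ suc) (f≤1 ∘ suc) λ i j p q → Fin.suc-injective (uniq (suc i) (suc j) p q)
... | suc a = subst (_≤ 1) (sym (trans (cong (suc a +_) (sumFin-zero k rest≡0)) (ℕ.+-identityʳ _)))
                (subst (_≤ 1) eq (f≤1 zero))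
  where
  f0≢0 : f zero ≢ 0
  f0≢0 p with () ← trans (sym eq) p
  rest≡0 : ∀ i → f (suc i) ≡ 0
  rest≡0 i with f (suc i) ℕ.≟ 0
  ... | yes p = p
  ... | no ¬p with () ← uniq zero (suc i) f0≢0 ¬p

sumFin≢0 : ∀ k (f : Fin k → ℕ) → sumFin k f ≢ 0 → ∃ λ i → f i ≢ 0
sumFin≢0 zero    f ≢0 = contradiction refl ≢0
sumFin≢0 (suc k) f ≢0 with f zero ℕ.≟ 0
... | no p  = zero , p
... | yes p with i , q ← sumFin≢0 k (f ∘ suc) (λ r → ≢0 (cong₂ _+_ p r)) = suc i , q

sumFuns : ∀ n m → ((Fin n → Fin m) → ℕ) → ℕ
sumFuns zero    m h = h (λ ())
sumFuns (suc n) m h = sumFin m λ i → sumFuns n m λ f → h (i ◂ f)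

countFuns≡sumFuns : ∀ n m p → countFuns n m p ≡ sumFuns n m (b2n ∘ p)
countFuns≡sumFuns zero    m p = refl
countFuns≡sumFuns (suc n) m p = sumFin-cong m λ i → countFuns≡sumFuns n m λ f → p (i ◂ f)

sumFuns-mono : ∀ n m {h k : (Fin n → Fin m) → ℕ} → (∀ f → h f ≤ k f) → sumFuns n m h ≤ sumFuns n m k
sumFuns-mono zero    m h≤k = h≤k _
sumFuns-mono (suc n) m h≤k = sumFin-mono m λ i → sumFuns-mono n m λ f → h≤k (i ◂ f)

sumFuns-cong : ∀ n m {h k : (Fin n → Fin m) → ℕ} → (∀ f → h f ≡ k f) → sumFuns n m h ≡ sumFuns n m k
sumFuns-cong n m h≗k = ℕ.≤-antisym (sumFuns-mono n m (ℕ.≤-reflexive ∘ h≗k))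
                                   (sumFuns-mono n m (ℕ.≤-reflexive ∘ sym ∘ h≗k))

sumFuns-+ : ∀ n m (h k : (Fin n → Fin m) → ℕ) →
  sumFuns n m (λ f → h f + k f) ≡ sumFuns n m h + sumFuns n m k
sumFuns-+ zero    m h k = refl
sumFuns-+ (suc n) m h k = trans
  (sumFin-cong m λ i → sumFuns-+ n m (λ f → h (i ◂ f)) (λ f → k (i ◂ f)))
  (sumFin-+ m _ _)

sumFuns-zero : ∀ n m {h : (Fin n → Fin m) → ℕ} → (∀ f → h f ≡ 0) → sumFuns n m h ≡ 0
sumFuns-zero zero    m h≗0 = h≗0 _
sumFuns-zero (suc n) m h≗0 = sumFin-zero m λ i → sumFuns-zero n m λ f → h≗0 (i ◂ f)

sumFin-sumFuns : ∀ k n m (h : Fin k → (Fin n → Fin m) → ℕ) →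
  sumFin k (λ i → sumFuns n m (h i)) ≡ sumFuns n m (λ f → sumFin k (λ i → h i f))
sumFin-sumFuns zero    n m h = sym (sumFuns-zero n m λ _ → refl)
sumFin-sumFuns (suc k) n m h = trans
  (cong (sumFuns n m (h zero) +_) (sumFin-sumFuns k n m (h ∘ suc)))
  (sym (sumFuns-+ n m (h zero) _))

-- h and k are compared up to pointwise equality of functions, since
-- functions built by _◂_ are not definitionally equal to f ∘ σ.
sumFuns-permute : ∀ n m {h k : (Fin n → Fin m) → ℕ} (σ : Fin n → Permutation′ m) →
  (∀ f g → (∀ v → g v ≡ σ v ⟨$⟩ʳ f v) → h f ≡ k g) → sumFuns n m h ≡ sumFuns n m k
sumFuns-permute zero    m σ h≈k = h≈k _ _ λ ()
sumFuns-permute (suc n) m {h} {k} σ h≈k = trans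
  (sumFin-cong m λ i → sumFuns-permute n m (σ ∘ suc) λ f g g≗σf →
    h≈k (i ◂ f) ((σ zero ⟨$⟩ʳ i) ◂ g) λ { zero → refl ; (suc v) → g≗σf v })
  (sumFin-permute m (λ j → sumFuns n m λ f → k (j ◂ f)) (σ zero))

#outside : ∀ {n} → (Fin n → Bool) → ℕ
#outside {n} S = sumFin n (b2n ∘ not ∘ S)

AgreeOff : ∀ {n} {A : Set} → (Fin n → Bool) → (Fin n → A) → (Fin n → A) → Set
AgreeOff S f g = ∀ v → S v ≡ false → f v ≡ g v

sumFuns-≤ : ∀ n m (h : (Fin n → Fin m) → ℕ) (S : Fin n → Bool) → (∀ f → h f ≤ 1) →
  (∀ f g → h f ≢ 0 → h g ≢ 0 → AgreeOff S f g → ∀ v → f v ≡ g v) →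
  sumFuns n m h ≤ m ^ #outside S
sumFuns-≤ zero    m h S h≤1 det = h≤1 _
sumFuns-≤ (suc n) m h S h≤1 det with S zero in S0
... | false = begin
  sumFin m (λ i → sumFuns n m λ f → h (i ◂ f))  ≤⟨ sumFin-mono m (λ i → sumFuns-≤ n m _ (S ∘ suc) (λ f → h≤1 (i ◂ f))
                                                     λ f g p q f~g v → det (i ◂ f) (i ◂ g) p q
                                                       (λ { zero _ → refl ; (suc v) → f~g v }) (suc v)) ⟩
  sumFin m (λ _ → m ^ #outside (S ∘ suc))       ≡⟨ sumFin-const m _ ⟩
  m * m ^ #outside (S ∘ suc)                    ∎
  where open ℕ.≤-Reasoning
... | true  = begin
  sumFin m (λ i → sumFuns n m λ f → h (i ◂ f))  ≡⟨ sumFin-sumFuns m n m _ ⟩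
  sumFuns n m (λ f → sumFin m λ i → h (i ◂ f))  ≤⟨ sumFuns-≤ n m _ (S ∘ suc)
                                                     (λ f → sumFin-≤1 m _ (λ i → h≤1 (i ◂ f))
                                                       λ i j p q → det (i ◂ f) (j ◂ f) p q (agree (λ _ _ → refl)) zero)
                                                     tail ⟩
  m ^ #outside (S ∘ suc)                        ∎
  where
  open ℕ.≤-Reasoning
  agree : ∀ {i j f g} → AgreeOff (S ∘ suc) f g → AgreeOff S (i ◂ f) (j ◂ g)
  agree f~g zero    ¬S0 with () ← trans (sym S0) ¬S0
  agree f~g (suc v) ¬Sv = f~g v ¬Sv
  tail : ∀ f g → sumFin m (λ i → h (i ◂ f)) ≢ 0 → sumFin m (λ i → h (i ◂ g)) ≢ 0 →
    AgreeOff (S ∘ suc) f g → ∀ v → f v ≡ g v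
  tail f g p q f~g v with i , p′ ← sumFin≢0 m _ p | j , q′ ← sumFin≢0 m _ q =
    det (i ◂ f) (j ◂ g) p′ q′ (agree f~g) (suc v)

-- Positivity is asked of every `f′` pointwise equal to `f`, because `h` need not respect pointwise
-- equality and the recursion rebuilds functions by `_◂_`.
sumFuns-≥ : ∀ n m .{{_ : NonZero m}} (h : (Fin n → Fin m) → ℕ) (S : Fin n → Bool) →
  (∀ g → ∃ λ f → AgreeOff S f g × (∀ f′ → (∀ v → f′ v ≡ f v) → 1 ≤ h f′)) →
  m ^ #outside S ≤ sumFuns n m h
sumFuns-≥ zero    m h S ext = proj₂ (proj₂ (ext λ ())) _ λ ()
sumFuns-≥ (suc n) m@(suc _) h S ext with S zero in S0
... | false = begin
  m * m ^ #outside (S ∘ suc)                    ≡⟨ sumFin-const m _ ⟨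
  sumFin m (λ _ → m ^ #outside (S ∘ suc))       ≤⟨ sumFin-mono m (λ i → sumFuns-≥ n m _ (S ∘ suc) (ext′ i)) ⟩
  sumFin m (λ i → sumFuns n m λ f → h (i ◂ f))  ∎
  where
  open ℕ.≤-Reasoning
  ext′ : ∀ i g → ∃ λ f → AgreeOff (S ∘ suc) f g × (∀ f′ → (∀ v → f′ v ≡ f v) → 1 ≤ h (i ◂ f′))
  ext′ i g with f , f~g , positive ← ext (i ◂ g) = f ∘ suc , f~g ∘ suc ,
    λ f′ f′≗f → positive (i ◂ f′) λ { zero → sym (f~g zero S0) ; (suc v) → f′≗f v }
... | true  = begin
  m ^ #outside (S ∘ suc)                        ≤⟨ sumFuns-≥ n m _ (S ∘ suc) ext′ ⟩
  sumFuns n m (λ f → sumFin m λ i → h (i ◂ f))  ≡⟨ sumFin-sumFuns m n m (λ i f → h (i ◂ f)) ⟨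
  sumFin m (λ i → sumFuns n m λ f → h (i ◂ f))  ∎
  where
  open ℕ.≤-Reasoning
  ext′ : ∀ g → ∃ λ f → AgreeOff (S ∘ suc) f g × (∀ f′ → (∀ v → f′ v ≡ f v) → 1 ≤ sumFin m λ i → h (i ◂ f′))
  ext′ g with f , f~g , positive ← ext (zero ◂ g) = f ∘ suc , f~g ∘ suc ,
    λ f′ f′≗f → ℕ.≤-trans (positive (f zero ◂ f′) λ { zero → refl ; (suc v) → f′≗f v })
                          (term≤sumFin m (λ i → h (i ◂ f′)) (f zero))

-- Walks, circuits and chords

data Walk {V : Set} (E : V → V → Set) : V → List V → V → Set where
  stop : ∀ {x} → Walk E x [] x
  go   : ∀ {x y ys z} → E x y → Walk E y ys z → Walk E x (y ∷ ys) z

module _ {V : Set} {E : V → V → Set} where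

  Walk-++ : ∀ {x xs y ys z} → Walk E x xs y → Walk E y ys z → Walk E x (xs ++ ys) z
  Walk-++ stop      w′ = w′
  Walk-++ (go e w) w′ = go e (Walk-++ w w′)

  Walk-map : ∀ {F : V → V → Set} → (∀ {x y} → E x y → F x y) →
    ∀ {x ys z} → Walk E x ys z → Walk F x ys z
  Walk-map f stop     = stop
  Walk-map f (go e w) = go (f e) (Walk-map f w)

  Walk-split : ∀ {x ys z a} → Walk E x ys z → a ∈ x ∷ ys →
    ∃ λ p → ∃ λ q → Walk E x p a × Walk E a q z × ys ≡ p ++ q
  Walk-split w        (here refl) = [] , _ , stop , w , refl
  Walk-split (go e w) (there a∈) with p , q , w₁ , w₂ , eq ← Walk-split w a∈ =
    _ ∷ p , q , go e w₁ , w₂ , cong (_ ∷_) eq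

  last⊆tail : ∀ {x y ys z} → Walk E x (y ∷ ys) z → [ z ] ⊆ y ∷ ys
  last⊆tail (go _ stop)         = ⊆-refl
  last⊆tail (go _ w@(go _ _)) = _ ∷ʳ last⊆tail w

  last⊆ : ∀ {x ys z} → Walk E x ys z → [ z ] ⊆ x ∷ ys
  last⊆ stop         = ⊆-refl
  last⊆ w@(go _ _) = _ ∷ʳ last⊆tail w

  last∈ : ∀ {x ys z} → Walk E x ys z → z ∈ x ∷ ys
  last∈ stop     = here refl
  last∈ (go _ w) = there (last∈ w)

Unique-⊆ : ∀ {A : Set} {xs ys : List A} → xs ⊆ ys → Unique ys → Unique xs
Unique-⊆ []         _          = []
Unique-⊆ (y ∷ʳ τ)   (_ ∷ uniq) = Unique-⊆ τ uniq
Unique-⊆ (refl ∷ τ) (x∉ ∷ uniq) = All-resp-⊆ τ x∉ ∷ Unique-⊆ τ uniq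

-- The closed walk start, tail, start; end is the last vertex of tail.
record Circuit {V : Set} (E : V → V → Set) : Set where
  constructor circuit
  field
    {start} : V
    {tail}  : List V
    {end}   : V
    walk    : Walk E start tail end
    close   : E end start
    unique  : Unique (start ∷ tail)
    long    : 2 ≤ length tail
  vertices : List V
  vertices = start ∷ tail
  size : ℕ
  size = length vertices
open Circuit

Circuit-map : ∀ {V : Set} {E F : V → V → Set} → (∀ {x y} → E x y → F x y) → Circuit E → Circuit F
Circuit-map f (circuit w c u l) = circuit (Walk-map f w) (f c) u l

walkSum : ∀ {V : Set} → (V → V → ℤ) → V → List V → ℤ
walkSum w x []       = 0ℤ
walkSum w x (y ∷ ys) = w x y +ᶻ walkSum w y ys

circuitSum : ∀ {V : Set} {E : V → V → Set} → (V → V → ℤ) → Circuit E → ℤ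
circuitSum w C = walkSum w (start C) (tail C) +ᶻ w (end C) (start C)

walkSum-++ : ∀ {V : Set} {E : V → V → Set} w {x xs y} ys → Walk E x xs y →
  walkSum w x (xs ++ ys) ≡ walkSum w x xs +ᶻ walkSum w y ys
walkSum-++ w ys stop = sym (ℤ.+-identityˡ _)
walkSum-++ w {x} {y ∷ xs} ys (go _ W) =
  trans (cong (w x y +ᶻ_) (walkSum-++ w ys W)) (sym (ℤ.+-assoc (w x y) _ _))

-- Undirected edges and the edge lists of circuits

module _ {n : ℕ} where

  private V = Fin n

  -- Edges are stored with the smaller endpoint first.
  undirected : V → V → V × V
  undirected x y with x Fin.<? y
  ... | yes _ = x , y
  ... | no  _ = y , x

  undirected-< : ∀ {x y} → x Fin.< y → undirected x y ≡ (x , y)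
  undirected-< {x} {y} x<y with x Fin.<? y
  ... | yes _  = refl
  ... | no x≮y = contradiction x<y x≮y

  undirected-sym : ∀ x y → undirected x y ≡ undirected y x
  undirected-sym x y with x Fin.<? y | y Fin.<? x
  ... | yes _   | no _    = refl
  ... | no _    | yes _   = refl
  ... | yes x<y | yes y<x = contradiction x<y (ℕ.<⇒≯ y<x)
  ... | no x≮y  | no y≮x  with refl ← Fin.toℕ-injective (ℕ.≤-antisym (ℕ.≮⇒≥ y≮x) (ℕ.≮⇒≥ x≮y)) = refl

  undirected-ends : ∀ x y → undirected x y ≡ (x , y) ⊎ undirected x y ≡ (y , x)
  undirected-ends x y with x Fin.<? y
  ... | yes _ = inj₁ refl
  ... | no  _ = inj₂ refl

  undirected-injective : ∀ {x y a b} → undirected x y ≡ undirected a b → (x ≡ a × y ≡ b) ⊎ (x ≡ b × y ≡ a)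
  undirected-injective {x} {y} {a} {b} eq with undirected-ends x y | undirected-ends a b
  ... | inj₁ p | inj₁ q with refl ← trans (sym p) (trans eq q) = inj₁ (refl , refl)
  ... | inj₁ p | inj₂ q with refl ← trans (sym p) (trans eq q) = inj₂ (refl , refl)
  ... | inj₂ p | inj₁ q with refl ← trans (sym p) (trans eq q) = inj₂ (refl , refl)
  ... | inj₂ p | inj₂ q with refl ← trans (sym p) (trans eq q) = inj₁ (refl , refl)

  Joined : List (V × V) → V → V → Set
  Joined A x y = undirected x y ∈ A

  Joined-sym : ∀ A {x y} → Joined A x y → Joined A y x
  Joined-sym A {x} {y} = subst (_∈ A) (undirected-sym x y)

  walkEdges : V → List V → List (V × V)
  walkEdges x []       = []
  walkEdges x (y ∷ ys) = undirected x y ∷ walkEdges y ys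

  circuitEdges : ∀ {E : V → V → Set} → Circuit E → List (V × V)
  circuitEdges C = undirected (end C) (start C) ∷ walkEdges (start C) (tail C)

  length-walkEdges : ∀ x ys → length (walkEdges x ys) ≡ length ys
  length-walkEdges x []       = refl
  length-walkEdges x (y ∷ ys) = cong suc (length-walkEdges y ys)

  walkEdges-++ : ∀ {E : V → V → Set} {x xs y} ys → Walk E x xs y →
    walkEdges x (xs ++ ys) ≡ walkEdges x xs ++ walkEdges y ys
  walkEdges-++ ys stop     = refl
  walkEdges-++ ys (go _ W) = cong (_ ∷_) (walkEdges-++ ys W)

  walkEdges-ends : ∀ {a b} x ys → undirected a b ∈ walkEdges x ys → a ∈ x ∷ ys × b ∈ x ∷ ys
  walkEdges-ends x (y ∷ ys) (here eq) with undirected-injective eq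
  ... | inj₁ (refl , refl) = here refl , there (here refl)
  ... | inj₂ (refl , refl) = there (here refl) , here refl
  walkEdges-ends x (y ∷ ys) (there e∈) with p , q ← walkEdges-ends y ys e∈ = there p , there q

  circuitEdges-ends : ∀ {E : V → V → Set} (C : Circuit E) {a b} → undirected a b ∈ circuitEdges C →
    a ∈ vertices C × b ∈ vertices C
  circuitEdges-ends C (here eq) with undirected-injective eq
  ... | inj₁ (refl , refl) = last∈ (walk C) , here refl
  ... | inj₂ (refl , refl) = here refl , last∈ (walk C)
  circuitEdges-ends C (there e∈) = walkEdges-ends (start C) (tail C) e∈

  walkEdges⊆ : ∀ A {x ys z} → Walk (Joined A) x ys z → ∀ {e} → e ∈ walkEdges x ys → e ∈ A
  walkEdges⊆ A (go e W) (here refl) = e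
  walkEdges⊆ A (go e W) (there e∈) = walkEdges⊆ A W e∈

  circuitEdges⊆ : ∀ A (C : Circuit (Joined A)) → ∀ {e} → e ∈ circuitEdges C → e ∈ A
  circuitEdges⊆ A C (here refl) = close C
  circuitEdges⊆ A C (there e∈) = walkEdges⊆ A (walk C) e∈

  walkEdges-unique : ∀ x ys → Unique (x ∷ ys) → Unique (walkEdges x ys)
  walkEdges-unique x []       _ = []
  walkEdges-unique x (y ∷ ys) uniq@(_ ∷ uniq′) =
    ¬Any⇒All¬ _ (λ e∈ → Unique[x∷xs]⇒x∉xs uniq (proj₁ (walkEdges-ends y ys e∈))) ∷ walkEdges-unique y ys uniq′

  closing∉ : ∀ {E : V → V → Set} {x ys z} → Walk E x ys z → Unique (x ∷ ys) → 2 ≤ length ys →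
    undirected z x ∉ walkEdges x ys
  closing∉ (go _ W@(go _ W′)) uniq@(_ ∷ uniq′) _ (here eq) with undirected-injective eq
  ... | inj₁ (_ , refl)  = Unique[x∷xs]⇒x∉xs uniq (here refl)
  ... | inj₂ (refl , _)  = Unique[x∷xs]⇒x∉xs uniq′ (last∈ W′)
  closing∉ {ys = y ∷ ys} (go _ W) uniq _ (there e∈) = Unique[x∷xs]⇒x∉xs uniq (proj₂ (walkEdges-ends y ys e∈))
  closing∉ (go _ stop) _ (s≤s ())

  -- This rests on `long`: a closed walk on two vertices would use one edge twice. Freedom from
  -- duplicates lets the number of edges of a circuit be compared with the length of an edge list.
  circuitEdges-unique : ∀ {E : V → V → Set} (C : Circuit E) → Unique (circuitEdges C)
  circuitEdges-unique C = ¬Any⇒All¬ _ (closing∉ (walk C) (unique C) (long C)) ∷ walkEdges-unique _ _ (unique C)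

  module Chords {E : V → V → Set} (E-sym : ∀ {x y} → E x y → E y x)
                (w : V → V → ℤ) (w-anti : ∀ x y → w y x ≡ -ᶻ w x y) where

    private
      sum-zero : ∀ p q s c e → q +ᶻ -ᶻ e ≡ 0ℤ → (p +ᶻ (e +ᶻ s)) +ᶻ c ≡ 0ℤ → (p +ᶻ (q +ᶻ s)) +ᶻ c ≡ 0ℤ
      sum-zero p q s c e h₁ h₂ = trans (rearrange p q s c e) (cong₂ _+ᶻ_ h₁ h₂)
        where
        rearrange : ∀ p q s c e → (p +ᶻ (q +ᶻ s)) +ᶻ c ≡ (q +ᶻ -ᶻ e) +ᶻ ((p +ᶻ (e +ᶻ s)) +ᶻ c)
        rearrange = solve-∀

    -- A chord ab cuts C into two shorter circuits, whose sums add up to that of C.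
    chord-ordered : ∀ {x p a q b s z} → Walk E x p a → Walk E a q b → Walk E b s z → (xz : E z x) →
      Unique (x ∷ p ++ q ++ s) →
      (∀ (C : Circuit E) → size C < suc (length (p ++ q ++ s)) → circuitSum w C ≡ 0ℤ) →
      walkSum w x (p ++ q ++ s) +ᶻ w z x ≢ 0ℤ → a ≢ b → E a b →
      undirected a b ∈ undirected z x ∷ walkEdges x (p ++ q ++ s)
    chord-ordered Wp stop Ws xz uniq short ≢0 a≢b eab = contradiction refl a≢b
    chord-ordered {p = p} {s = s} Wp (go {y = y} e stop) Ws xz uniq short ≢0 a≢b eab =
      there (subst (_ ∈_) (sym (walkEdges-++ (y ∷ s) Wp)) (∈-++⁺ʳ (walkEdges _ p) (here refl)))
    chord-ordered stop (go _ (go _ _)) stop xz uniq short ≢0 a≢b eab = here (undirected-sym _ _)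
    -- If `p` and `s` are both empty, `ab` is the closing edge. Otherwise both pieces have at least
    -- three vertices and fewer than the whole circuit.
    chord-ordered {x} {p} {a} {q@(_ ∷ _ ∷ q′)} {b} {s} {z} Wp Wq@(go _ (go _ _)) Ws xz uniq short ≢0 a≢b eab with p ++ s in ps
    ... | [] with p | s | Wp | Ws
    ...   | [] | [] | stop | stop = here (undirected-sym _ _)
    chord-ordered {x} {p} {a} {q@(_ ∷ _ ∷ q′)} {b} {s} {z} Wp Wq@(go _ (go _ _)) Ws xz uniq short ≢0 a≢b eab | r ∷ rs =
      contradiction total≡0 ≢0
      where
      |p|+|s| : length p + length s ≡ suc (length rs)
      |p|+|s| = trans (sym (length-++ p)) (cong length ps)

      |pqs| : length (p ++ q ++ s) ≡ length p + (length q + length s)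
      |pqs| = trans (length-++ p) (cong (length p +_) (length-++ q))

      |pqs|′ : length (p ++ q ++ s) ≡ length q + suc (length rs)
      |pqs|′ = trans |pqs| (trans (x∙yz≈y∙xz (length p) (length q) (length s)) (cong (length q +_) |p|+|s|))

      C₁ C₂ : Circuit E
      C₁ = circuit Wq (E-sym eab)
             (Unique-⊆ (++⁺ (last⊆ Wp) (++⁺ʳ s ⊆-refl)) uniq)
             (s≤s (s≤s z≤n))
      C₂ = circuit (Walk-++ Wp (go eab Ws)) xz
             (Unique-⊆ (++⁺ (⊆-refl {x = x ∷ p}) (++⁺ (last⊆tail Wq) ⊆-refl)) uniq)
             (subst (2 ≤_) (sym (trans (length-++ p) (trans (ℕ.+-suc _ _) (cong suc |p|+|s|)))) (s≤s (s≤s z≤n)))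

      C₁-short : size C₁ < suc (length (p ++ q ++ s))
      C₁-short = s≤s (subst (size C₁ ≤_) (sym |pqs|′) (ℕ.≤-trans (ℕ.m≤m+n _ (length rs)) (ℕ.≤-reflexive (sym (ℕ.+-suc (length q) _)))))

      C₂-short : size C₂ < suc (length (p ++ q ++ s))
      C₂-short = s≤s (subst₂ _≤_ (cong suc (sym (length-++ p))) (sym |pqs|)
        (ℕ.≤-trans (ℕ.≤-reflexive (sym (ℕ.+-suc (length p) _))) (ℕ.+-monoʳ-≤ (length p) (s≤s (s≤s (ℕ.m≤n+m _ (length q′)))))))

      -- The two circuits traverse the chord in opposite directions, so antisymmetry of `w` cancels
      -- its contribution.
      total≡0 : walkSum w x (p ++ q ++ s) +ᶻ w z x ≡ 0ℤ
      total≡0 = trans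
        (cong (_+ᶻ w z x) (trans (walkSum-++ w (q ++ s) Wp) (cong (walkSum w x p +ᶻ_) (walkSum-++ w s Wq))))
        (sum-zero (walkSum w x p) (walkSum w a q) (walkSum w b s) (w z x) (w a b)
          (trans (cong (walkSum w a q +ᶻ_) (sym (w-anti a b))) (short C₁ C₁-short))
          (trans (cong (_+ᶻ w z x) (sym (walkSum-++ w (b ∷ s) Wp))) (short C₂ C₂-short)))

    chord : (C : Circuit E) → (∀ (C′ : Circuit E) → size C′ < size C → circuitSum w C′ ≡ 0ℤ) →
      circuitSum w C ≢ 0ℤ → ∀ {a b} → a ∈ vertices C → b ∈ vertices C → a ≢ b → E a b →
      undirected a b ∈ circuitEdges C
    chord (circuit W xz uniq l) short ≢0 {a} {b} a∈ b∈ a≢b eab with Walk-split W a∈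
    ... | p , q , Wp , Wq , refl with ∈-++⁻ (_ ∷ p) b∈
    -- Here `b` precedes `a` along the walk, so the chord is read from `b` to `a`.
    ...   | inj₁ b∈p with p₁ , p₂ , Wp₁ , Wp₂ , refl ← Walk-split Wp b∈p
              rewrite ++-assoc p₁ p₂ q =
            subst (_∈ _) (undirected-sym b a) (chord-ordered Wp₁ Wp₂ Wq xz uniq short ≢0 (a≢b ∘ sym) (E-sym eab))
    ...   | inj₂ b∈q with q₁ , q₂ , Wq₁ , Wq₂ , refl ← Walk-split Wq (there b∈q) =
            chord-ordered Wp Wq₁ Wq₂ xz uniq short ≢0 a≢b eab

-- Potentials

module Potentials {n : ℕ} (w : Fin n → Fin n → ℤ) (w-anti : ∀ x y → w y x ≡ -ᶻ w x y) where

  private V = Fin n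

  -- label names the connected component of a vertex.
  record Potential (A : List (V × V)) : Set where
    field
      label      : V → V
      pot        : V → ℤ
      label-edge : ∀ {u v} → Joined A u v → label u ≡ label v
      pot-edge   : ∀ {u v} → Joined A u v → pot v ≡ pot u +ᶻ w u v
      connect    : ∀ u v → label u ≡ label v → ∃ λ ys → Walk (Joined A) u ys v × Unique (u ∷ ys)

    label-walk : ∀ {x ys z} → Walk (Joined A) x ys z → All (λ y → label y ≡ label x) (x ∷ ys)
    label-walk stop     = refl ∷ []
    label-walk (go e W) = refl ∷ All.map (λ eq → trans eq (sym (label-edge e))) (label-walk W)

    pot-walk : ∀ {x ys z} → Walk (Joined A) x ys z → pot z ≡ pot x +ᶻ walkSum w x ys
    pot-walk stop     = sym (ℤ.+-identityʳ _)
    pot-walk (go {x} {y} {ys} e W) =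
      trans (pot-walk W) (trans (cong (_+ᶻ walkSum w y ys) (pot-edge e)) (ℤ.+-assoc (pot x) _ _))

  open Potential

  private
    move : ∀ b a c → b ≡ a +ᶻ c → a ≡ b +ᶻ -ᶻ c
    move b a c eq = trans (cancel a c) (cong (_+ᶻ -ᶻ c) (sym eq))
      where
      cancel : ∀ a c → a ≡ (a +ᶻ c) +ᶻ -ᶻ c
      cancel = solve-∀

    pot-edge-sym : ∀ {pu pv u v} → pv ≡ pu +ᶻ w u v → pu ≡ pv +ᶻ w v u
    pot-edge-sym {pu} {pv} {u} {v} eq = trans (move pv pu (w u v) eq) (cong (pv +ᶻ_) (sym (w-anti u v)))

  Joined-∷⁻ : ∀ {A} {a b u v : V} → a Fin.< b → Joined ((a , b) ∷ A) u v → ((u ≡ a × v ≡ b) ⊎ (u ≡ b × v ≡ a)) ⊎ Joined A u v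
  Joined-∷⁻ a<b (here eq)  = inj₁ (undirected-injective (trans eq (sym (undirected-< a<b))))
  Joined-∷⁻ a<b (there e∈) = inj₂ e∈

  empty-potential : Potential []
  empty-potential = record
    { label      = id
    ; pot        = λ _ → 0ℤ
    ; label-edge = λ ()
    ; pot-edge   = λ ()
    ; connect    = λ { u .u refl → [] , stop , [] ∷ [] }
    }

  module _ {A : List (V × V)} (P : Potential A) {a b : V} (a<b : a Fin.< b) where

    private
      A⁺ = (a , b) ∷ A

      ab : Joined A⁺ a b
      ab = here (undirected-< a<b)

      ba : Joined A⁺ b a
      ba = Joined-sym A⁺ ab

    keep-potential : label P a ≡ label P b → pot P b ≡ pot P a +ᶻ w a b → Potential A⁺
    keep-potential same eq = record
      { label      = label P
      ; pot        = pot P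
      ; label-edge = λ {u} {v} e → label-edge⁺ {u} {v} (Joined-∷⁻ a<b e)
      ; pot-edge   = λ {u} {v} e → pot-edge⁺ {u} {v} (Joined-∷⁻ a<b e)
      ; connect    = λ u v p → let ys , W , uniq = connect P u v p in ys , Walk-map there W , uniq
      }
      where
      label-edge⁺ : ∀ {u v} → ((u ≡ a × v ≡ b) ⊎ (u ≡ b × v ≡ a)) ⊎ Joined A u v → label P u ≡ label P v
      label-edge⁺ (inj₁ (inj₁ (refl , refl))) = same
      label-edge⁺ (inj₁ (inj₂ (refl , refl))) = sym same
      label-edge⁺ (inj₂ e)                    = label-edge P e
      pot-edge⁺ : ∀ {u v} → ((u ≡ a × v ≡ b) ⊎ (u ≡ b × v ≡ a)) ⊎ Joined A u v → pot P v ≡ pot P u +ᶻ w u v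
      pot-edge⁺ (inj₁ (inj₁ (refl , refl))) = eq
      pot-edge⁺ (inj₁ (inj₂ (refl , refl))) = pot-edge-sym eq
      pot-edge⁺ (inj₂ e)                    = pot-edge P e

    -- A simple path from `a` to `b` in `A` accumulates the difference of their potentials. This
    -- differs from `w a b`, so returning along the new edge leaves a nonzero sum. A path of a
    -- single edge would put `ab` in `A` already and contradict the conflict.
    close-circuit : label P a ≡ label P b → pot P b ≢ pot P a +ᶻ w a b →
      Σ (Circuit (Joined A⁺)) λ C → circuitSum w C ≢ 0ℤ
    close-circuit same conflict with connect P a b same
    ... | [] , stop , _ = contradiction refl (Fin.<⇒≢ a<b)
    ... | _ ∷ [] , go e stop , _ = contradiction (pot-edge P e) conflict
    ... | ys@(_ ∷ _ ∷ _) , W , uniq = circuit (Walk-map there W) ba uniq (s≤s (s≤s z≤n)) , sum≢0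
      where
      step : ∀ p s c → p +ᶻ s ≡ (p +ᶻ c) +ᶻ (s +ᶻ -ᶻ c)
      step = solve-∀
      sum≢0 : walkSum w a ys +ᶻ w b a ≢ 0ℤ
      sum≢0 sum≡0 = conflict (begin
        pot P b                                               ≡⟨ pot-walk P W ⟩
        pot P a +ᶻ walkSum w a ys                             ≡⟨ step (pot P a) (walkSum w a ys) (w a b) ⟩
        (pot P a +ᶻ w a b) +ᶻ (walkSum w a ys +ᶻ -ᶻ w a b)    ≡⟨ cong (λ t → (pot P a +ᶻ w a b) +ᶻ (walkSum w a ys +ᶻ t)) (w-anti a b) ⟨
        (pot P a +ᶻ w a b) +ᶻ (walkSum w a ys +ᶻ w b a)       ≡⟨ cong ((pot P a +ᶻ w a b) +ᶻ_) sum≡0 ⟩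
        (pot P a +ᶻ w a b) +ᶻ 0ℤ                              ≡⟨ ℤ.+-identityʳ _ ⟩
        pot P a +ᶻ w a b                                      ∎)
        where open ≡-Reasoning

    merge-potential : label P a ≢ label P b → Potential A⁺
    merge-potential differ = record
      { label      = label⁺
      ; pot        = pot⁺
      ; label-edge = λ {u} {v} e → label-edge⁺ {u} {v} (Joined-∷⁻ a<b e)
      ; pot-edge   = λ {u} {v} e → pot-edge⁺ {u} {v} (Joined-∷⁻ a<b e)
      ; connect    = connect⁺
      }
      where
      -- The constant which, added on the whole component of `b`, makes the new edge fit; potential
      -- differences inside that component are unchanged.
      shift : ℤ
      shift = (pot P a +ᶻ w a b) +ᶻ -ᶻ pot P b

      label⁺ : V → V
      label⁺ t with label P t Fin.≟ label P b
      ... | yes _ = label P a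
      ... | no  _ = label P t

      pot⁺ : V → ℤ
      pot⁺ t with label P t Fin.≟ label P b
      ... | yes _ = pot P t +ᶻ shift
      ... | no  _ = pot P t

      label⁺-ab : label⁺ a ≡ label⁺ b
      label⁺-ab with label P a Fin.≟ label P b | label P b Fin.≟ label P b
      ... | yes p | _     = contradiction p differ
      ... | no  _ | yes _ = refl
      ... | no  _ | no ¬p = contradiction refl ¬p

      pot⁺-ab : pot⁺ b ≡ pot⁺ a +ᶻ w a b
      pot⁺-ab with label P a Fin.≟ label P b | label P b Fin.≟ label P b
      ... | yes p | _     = contradiction p differ
      ... | no  _ | yes _ = cancel (pot P b) (pot P a +ᶻ w a b)
        where
        cancel : ∀ x y → x +ᶻ (y +ᶻ -ᶻ x) ≡ y
        cancel = solve-∀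
      ... | no  _ | no ¬p = contradiction refl ¬p

      label-edge⁺ : ∀ {u v} → ((u ≡ a × v ≡ b) ⊎ (u ≡ b × v ≡ a)) ⊎ Joined A u v → label⁺ u ≡ label⁺ v
      label-edge⁺ (inj₁ (inj₁ (refl , refl))) = label⁺-ab
      label-edge⁺ (inj₁ (inj₂ (refl , refl))) = sym label⁺-ab
      label-edge⁺ {u} {v} (inj₂ e) with label P u Fin.≟ label P b | label P v Fin.≟ label P b
      ... | yes _ | yes _ = refl
      ... | yes p | no ¬q = contradiction (trans (sym (label-edge P e)) p) ¬q
      ... | no ¬p | yes q = contradiction (trans (label-edge P e) q) ¬p
      ... | no  _ | no  _ = label-edge P e

      pot-edge⁺ : ∀ {u v} → ((u ≡ a × v ≡ b) ⊎ (u ≡ b × v ≡ a)) ⊎ Joined A u v → pot⁺ v ≡ pot⁺ u +ᶻ w u v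
      pot-edge⁺ (inj₁ (inj₁ (refl , refl))) = pot⁺-ab
      pot-edge⁺ (inj₁ (inj₂ (refl , refl))) = pot-edge-sym pot⁺-ab
      pot-edge⁺ {u} {v} (inj₂ e) with label P u Fin.≟ label P b | label P v Fin.≟ label P b
      ... | yes p | no ¬q = contradiction (trans (sym (label-edge P e)) p) ¬q
      ... | no ¬p | yes q = contradiction (trans (label-edge P e) q) ¬p
      ... | no  _ | no  _ = pot-edge P e
      ... | yes _ | yes _ = trans (cong (_+ᶻ shift) (pot-edge P e)) (swap (pot P u) (w u v) shift)
        where
        swap : ∀ x y z → (x +ᶻ y) +ᶻ z ≡ (x +ᶻ z) +ᶻ y
        swap = solve-∀

      -- The two walks stay in different components, so their union is simple.
      join : ∀ {u x y v} → Joined A⁺ x y → label P u ≡ label P x → label P y ≡ label P v →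
        label P u ≢ label P v → ∃ λ ys → Walk (Joined A⁺) u ys v × Unique (u ∷ ys)
      join {u} {x} {y} {v} e ux yv u≢v with ps , W , uniq ← connect P u x ux | qs , W′ , uniq′ ← connect P y v yv =
        ps ++ y ∷ qs , Walk-++ (Walk-map there W) (go e (Walk-map there W′)) , Unique.++⁺ uniq uniq′ disjoint
        where
        disjoint : ∀ {t} → ¬ (t ∈ u ∷ ps × t ∈ y ∷ qs)
        disjoint (t∈₁ , t∈₂) = u≢v (trans (trans (sym (All.lookup (label-walk P W) t∈₁)) (All.lookup (label-walk P W′) t∈₂)) yv)

      connect⁺ : ∀ u v → label⁺ u ≡ label⁺ v → ∃ λ ys → Walk (Joined A⁺) u ys v × Unique (u ∷ ys)
      connect⁺ u v eq with label P u Fin.≟ label P b | label P v Fin.≟ label P b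
      ... | yes p | yes q = let ys , W , uniq = connect P u v (trans p (sym q)) in ys , Walk-map there W , uniq
      ... | yes p | no ¬q = join ba p eq λ uv → ¬q (trans (sym uv) p)
      ... | no ¬p | yes q = join ab eq (sym q) λ uv → ¬p (trans uv q)
      ... | no ¬p | no ¬q = let ys , W , uniq = connect P u v eq in ys , Walk-map there W , uniq

  -- Edges are added one at a time. An edge between two components merges them after a shift; an
  -- edge within a component either agrees with the potential or closes a circuit of nonzero sum.
  potential-or-circuit : ∀ A → All (λ (u , v) → u Fin.< v) A →
    Potential A ⊎ Σ (Circuit (Joined A)) λ C → circuitSum w C ≢ 0ℤ
  potential-or-circuit [] [] = inj₁ empty-potential
  potential-or-circuit ((a , b) ∷ A) (a<b ∷ A<) with potential-or-circuit A A<
  ... | inj₂ (C , ≢0) = inj₂ (Circuit-map there C , ≢0)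
  ... | inj₁ P with label P a Fin.≟ label P b
  ...   | no differ = inj₁ (merge-potential P a<b differ)
  ...   | yes same with pot P b ℤ.≟ pot P a +ᶻ w a b
  ...     | yes eq = inj₁ (keep-potential P a<b same eq)
  ...     | no conflict = inj₂ (close-circuit P a<b same conflict)

-- Counting solutions modulo m

does-true : ∀ {P : Set} (P? : Dec P) → does P? ≡ true → P
does-true (yes p) _ = p

module _ {A : Set} where

  all-true⁻ : ∀ (p : A → Bool) xs → all p xs ≡ true → ∀ {x} → x ∈ xs → p x ≡ true
  all-true⁻ p (x ∷ xs) eq x∈ with p x in px
  all-true⁻ p (x ∷ xs) eq (here refl) | true = px
  all-true⁻ p (x ∷ xs) eq (there x∈)  | true = all-true⁻ p xs eq x∈

  all-true⁺ : ∀ (p : A → Bool) xs → (∀ {x} → x ∈ xs → p x ≡ true) → all p xs ≡ true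
  all-true⁺ p []       _ = refl
  all-true⁺ p (x ∷ xs) h rewrite h (here refl) = all-true⁺ p xs (h ∘ there)

  all-cong : ∀ {p q : A → Bool} xs → (∀ {x} → x ∈ xs → p x ≡ q x) → all p xs ≡ all q xs
  all-cong []       h = refl
  all-cong (x ∷ xs) h = cong₂ _∧_ (h (here refl)) (all-cong xs (h ∘ there))

evenᵇ : ℕ → Bool
evenᵇ zero    = true
evenᵇ (suc k) = not (evenᵇ k)

even-double : ∀ k → evenᵇ (k + k) ≡ true
even-double zero    = refl
even-double (suc k) rewrite ℕ.+-suc k k | even-double k = refl

length-set : ∀ {A : Set} {xs ys : List A} → Unique xs → Unique ys →
  (∀ {x} → x ∈ xs → x ∈ ys) → (∀ {x} → x ∈ ys → x ∈ xs) → length xs ≡ length ys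
length-set uxs uys to from = ↭-length (∼bag⇒↭ (unique∧set⇒bag uxs uys (mk⇔ to from)))

module _ {n : ℕ} where

  open import Data.List.Membership.DecPropositional (Fin._≟_ {n}) public using (_∈?_)

  member : List (Fin n) → Fin n → Bool
  member xs v = does (v ∈? xs)

sum-indicator : ∀ {n} (x : Fin n) → sumFin n (λ v → b2n (does (v Fin.≟ x))) ≡ 1
sum-indicator {suc n} zero    = cong suc (sumFin-zero n λ _ → refl)
sum-indicator {suc n} (suc x) = sum-indicator x

length+#outside : ∀ {n} (xs : List (Fin n)) → Unique xs → length xs + #outside (member xs) ≡ n
length+#outside {n} []       _ = trans (sumFin-const n 1) (ℕ.*-identityʳ n)
length+#outside {n} (x ∷ xs) uniq@(_ ∷ uniq′) = begin
  suc (length xs) + #outside (member (x ∷ xs))                                ≡⟨ ℕ.+-suc (length xs) _ ⟨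
  length xs + suc (#outside (member (x ∷ xs)))                                ≡⟨ cong (λ t → length xs + (t + #outside (member (x ∷ xs)))) (sum-indicator x) ⟨
  length xs + (sumFin n (λ v → b2n (does (v Fin.≟ x))) + #outside (member (x ∷ xs)))
                                                                              ≡⟨ cong (length xs +_) (sumFin-+ n _ _) ⟨
  length xs + sumFin n (λ v → b2n (does (v Fin.≟ x)) + b2n (not (member (x ∷ xs) v)))
                                                                              ≡⟨ cong (length xs +_) (sumFin-cong n step) ⟩
  length xs + #outside (member xs)                                            ≡⟨ length+#outside xs uniq′ ⟩
  n                                                                           ∎
  where
  open ≡-Reasoning
  step : ∀ v → b2n (does (v Fin.≟ x)) + b2n (not (member (x ∷ xs) v)) ≡ b2n (not (member xs v))
  step v with v Fin.≟ x | v ∈? xs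
  ... | yes refl | yes v∈ = contradiction v∈ (Unique[x∷xs]⇒x∉xs uniq)
  ... | yes _    | no _   = refl
  ... | no _     | yes _  = refl
  ... | no _     | no _   = refl

unique-length≤ : ∀ {n} (xs : List (Fin n)) → Unique xs → length xs ≤ n
unique-length≤ xs uniq = subst (length xs ≤_) (length+#outside xs uniq) (ℕ.m≤m+n _ _)

#outside≡ : ∀ {n} (xs : List (Fin n)) → Unique xs → #outside (member xs) ≡ n ∸ length xs
#outside≡ {n} xs uniq = trans (sym (ℕ.m+n∸m≡n (length xs) _)) (cong (_∸ length xs) (length+#outside xs uniq))

-- Colours as residues modulo `m`

module Residues (m : ℕ) .{{_ : NonZero m}} where

  residue : Fin m → ℤ
  residue i = pos (toℕ i)

  small-multiple : ∀ {z} → pos m ∣ z → ∣ z ∣ < m → z ≡ 0ℤ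
  small-multiple {z} m∣z z<m with ∣ z ∣ in eq | ∣⇒∣ᵤ m∣z
  ... | zero  | _   = ℤ.∣i∣≡0⇒i≡0 eq
  ... | suc _ | m∣z′ = contradiction m∣z′ (ℕ.>⇒∤ z<m)

  residue-injective : ∀ {i j} → pos m ∣ residue j +ᶻ -ᶻ residue i → i ≡ j
  residue-injective {i} {j} m∣ = Fin.toℕ-injective (ℤ.+-injective
    (sym (ℤ.i-j≡0⇒i≡j (residue j) (residue i) (small-multiple m∣ small))))
    where
    small : ∣ residue j +ᶻ -ᶻ residue i ∣ < m
    small = subst (λ z → ∣ z ∣ < m) (sym (ℤ.m-n≡m⊖n (toℕ j) (toℕ i)))
      (ℕ.≤-<-trans (ℤ.∣m⊝n∣≤m⊔n (toℕ j) (toℕ i)) (ℕ.⊔-lub (Fin.toℕ<n j) (Fin.toℕ<n i)))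

  ∣-resp-diff : ∀ {x y} → pos m ∣ x +ᶻ -ᶻ y → pos m ∣ y → pos m ∣ x
  ∣-resp-diff {x} {y} m∣x-y m∣y = subst (pos m ∣_) (cancel x y) (∣m∣n⇒∣m+n m∣x-y m∣y)
    where
    cancel : ∀ x y → (x +ᶻ -ᶻ y) +ᶻ y ≡ x
    cancel = solve-∀

  rotate : ℤ → Fin m → Fin m
  rotate z i = fromℕ< (n%ℕd<d (residue i +ᶻ z) m)

  rotate-∣ : ∀ z i → pos m ∣ residue (rotate z i) +ᶻ -ᶻ (residue i +ᶻ z)
  rotate-∣ z i = divides (-ᶻ q) (begin
    residue (rotate z i) +ᶻ -ᶻ s                             ≡⟨ cong₂ (λ a b → pos a +ᶻ -ᶻ b) (Fin.toℕ-fromℕ< _) (a≡a%ℕn+[a/ℕn]*n s m) ⟩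
    pos (s %ℕ m) +ᶻ -ᶻ (pos (s %ℕ m) +ᶻ q ℤ.* pos m)         ≡⟨ cancel (pos (s %ℕ m)) q (pos m) ⟩
    -ᶻ q ℤ.* pos m                                           ∎)
    where
    open ≡-Reasoning
    s = residue i +ᶻ z
    q = s /ℕ m
    cancel : ∀ a b c → a +ᶻ -ᶻ (a +ᶻ b ℤ.* c) ≡ -ᶻ b ℤ.* c
    cancel = solve-∀

  rotate-inverse : ∀ z z′ → z +ᶻ z′ ≡ 0ℤ → ∀ i → rotate z (rotate z′ i) ≡ i
  rotate-inverse z z′ eq i = sym (residue-injective
    (subst (pos m ∣_) total (∣m∣n⇒∣m+n (rotate-∣ z (rotate z′ i)) (rotate-∣ z′ i))))
    where
    regroup : ∀ a b c z z′ → (a +ᶻ -ᶻ (b +ᶻ z)) +ᶻ (b +ᶻ -ᶻ (c +ᶻ z′)) ≡ (a +ᶻ -ᶻ c) +ᶻ -ᶻ (z +ᶻ z′)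
    regroup = solve-∀
    total : _ ≡ residue (rotate z (rotate z′ i)) +ᶻ -ᶻ residue i
    total = trans (regroup (residue (rotate z (rotate z′ i))) (residue (rotate z′ i)) (residue i) z z′)
      (trans (cong (λ t → (residue (rotate z (rotate z′ i)) +ᶻ -ᶻ residue i) +ᶻ -ᶻ t) eq) (ℤ.+-identityʳ _))

  rotation : ℤ → Permutation′ m
  rotation z = permutation (rotate z) (rotate (-ᶻ z))
    (rotate-inverse z (-ᶻ z) (ℤ.+-inverseʳ z)) (rotate-inverse (-ᶻ z) z (ℤ.+-inverseˡ z))

-- Solution counts and their order in `m`

module Expansion {n : ℕ} (m : ℕ) .{{_ : NonZero m}} where

  open Residues m

  private V = Fin n

  discrepancy : (V → V → ℤ) → (V → Fin m) → V × V → ℤ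
  discrepancy w f (u , v) = (residue (f v) +ᶻ -ᶻ residue (f u)) +ᶻ -ᶻ w u v

  satisfied? : ∀ w f e → Dec (pos m ∣ discrepancy w f e)
  satisfied? w f e = pos m ∣? discrepancy w f e

  satisfies : (V → V → ℤ) → (V → Fin m) → V × V → Bool
  satisfies w f e = does (satisfied? w f e)

  mixed : (V → V → ℤ) → List (V × V) → List (V × V) → (V → Fin m) → Bool
  mixed w A R f = all (satisfies w f) A ∧ all (not ∘ satisfies w f) R

  -- Interpolates between the two kinds of count: with `A` empty and `R` the edges of the graph it
  -- counts colourings, and with `R` empty it is a term of inclusion-exclusion.
  F : (V → V → ℤ) → List (V × V) → List (V × V) → ℕ
  F w A R = sumFuns n m (b2n ∘ mixed w A R)

  -- The single step of inclusion-exclusion: each `f` either violates or satisfies `e`.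
  F-split : ∀ w A e R → F w A (e ∷ R) + F w (e ∷ A) R ≡ F w A R
  F-split w A e R = trans (sym (sumFuns-+ n m _ _)) (sumFuns-cong n m λ f →
    split (all (satisfies w f) A) (satisfies w f e) (all (not ∘ satisfies w f) R))
    where
    split : ∀ a s r → b2n (a ∧ (not s ∧ r)) + b2n ((s ∧ a) ∧ r) ≡ b2n (a ∧ r)
    split false false r = refl
    split false true  r = refl
    split true  true  r = refl
    split true  false r = ℕ.+-identityʳ _

  0w : V → V → ℤ
  0w _ _ = 0ℤ

  module _ {w : V → V → ℤ} (w-anti : ∀ x y → w y x ≡ -ᶻ w x y) (A : List (V × V)) (f : V → Fin m)
           (sat : all (satisfies w f) A ≡ true) where

    private
      satisfied : ∀ {e} → e ∈ A → pos m ∣ discrepancy w f e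
      satisfied e∈ = does-true (satisfied? w f _) (all-true⁻ (satisfies w f) A sat e∈)

    joined-satisfied : ∀ {x y} → Joined A x y → pos m ∣ discrepancy w f (x , y)
    joined-satisfied {x} {y} e with undirected-ends x y
    ... | inj₁ eq = satisfied (subst (_∈ A) eq e)
    ... | inj₂ eq = subst (pos m ∣_)
      (trans (reverse (residue (f x)) (residue (f y)) (w y x))
             (cong (λ t → (residue (f y) +ᶻ -ᶻ residue (f x)) +ᶻ -ᶻ t) (sym (w-anti y x))))
      (∣m⇒∣-m (satisfied (subst (_∈ A) eq e)))
      where
      reverse : ∀ a b c → -ᶻ ((a +ᶻ -ᶻ b) +ᶻ -ᶻ c) ≡ (b +ᶻ -ᶻ a) +ᶻ -ᶻ (-ᶻ c)
      reverse = solve-∀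

    walk-satisfied : ∀ {x ys z} → Walk (Joined A) x ys z →
      pos m ∣ (residue (f z) +ᶻ -ᶻ residue (f x)) +ᶻ -ᶻ walkSum w x ys
    walk-satisfied {x} stop = divides 0ℤ (cancel (residue (f x)))
      where
      cancel : ∀ a → (a +ᶻ -ᶻ a) +ᶻ -ᶻ 0ℤ ≡ 0ℤ
      cancel = solve-∀
    walk-satisfied {x} {y ∷ ys} {z} (go e W) = subst (pos m ∣_)
      (telescope (residue (f x)) (residue (f y)) (residue (f z)) (w x y) (walkSum w y ys))
      (∣m∣n⇒∣m+n (joined-satisfied e) (walk-satisfied W))
      where
      telescope : ∀ a b c s t → ((b +ᶻ -ᶻ a) +ᶻ -ᶻ s) +ᶻ ((c +ᶻ -ᶻ b) +ᶻ -ᶻ t) ≡ (c +ᶻ -ᶻ a) +ᶻ -ᶻ (s +ᶻ t)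
      telescope = solve-∀

    -- Adding the edge congruences around the circuit cancels all residues and leaves only the
    -- shifts.
    circuit-satisfied : (C : Circuit (Joined A)) → pos m ∣ circuitSum w C
    circuit-satisfied C = subst (pos m ∣_)
      (telescope (residue (f (start C))) (residue (f (end C))) (walkSum w (start C) (tail C)) (w (end C) (start C)))
      (∣m⇒∣-m (∣m∣n⇒∣m+n (walk-satisfied (walk C)) (joined-satisfied (close C))))
      where
      telescope : ∀ a c s t → -ᶻ (((c +ᶻ -ᶻ a) +ᶻ -ᶻ s) +ᶻ ((a +ᶻ -ᶻ c) +ᶻ -ᶻ t)) ≡ s +ᶻ t
      telescope = solve-∀

  module _ (A : List (V × V)) (f : V → Fin m) where

    joined-constant : all (satisfies 0w f) A ≡ true → ∀ {x y} → Joined A x y → f x ≡ f y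
    joined-constant sat e = residue-injective
      (subst (pos m ∣_) (ℤ.+-identityʳ _) (joined-satisfied {w = 0w} (λ _ _ → refl) A f sat e))

    walk-constant : all (satisfies 0w f) A ≡ true → ∀ {x ys z} → Walk (Joined A) x ys z →
      All (λ y → f y ≡ f x) (x ∷ ys)
    walk-constant sat stop     = refl ∷ []
    walk-constant sat (go e W) = refl ∷ All.map (λ eq → trans eq (sym (joined-constant sat e))) (walk-constant sat W)

  constant-satisfies : ∀ (f : V → Fin m) {u v} → f u ≡ f v → satisfies 0w f (u , v) ≡ true
  constant-satisfies f {u} {v} eq = dec-true (satisfied? 0w f (u , v)) (divides 0ℤ
    (trans (ℤ.+-identityʳ _) (trans (cong (λ t → residue t +ᶻ -ᶻ residue (f u)) (sym eq)) (ℤ.+-inverseʳ (residue (f u))))))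

  module _ (w : V → V → ℤ) (w-anti : ∀ x y → w y x ≡ -ᶻ w x y) where

    open Potentials w w-anti

    -- Rotating each colour by the potential of its vertex turns w into 0.
    F-gauge : ∀ {A} → All (λ (u , v) → u Fin.< v) A → Potential A → F 0w A [] ≡ F w A []
    F-gauge {A} A< P = sumFuns-permute n m (λ v → rotation (pot v)) λ f g g≗σf →
      cong (λ b → b2n (b ∧ true)) (all-cong A λ {e} e∈ →
        does-⇔ (mk⇔ (∣-resp-diff (flip-∣ {discrepancy w g e} {discrepancy 0w f e} (shifted f g g≗σf e∈)))
                    (∣-resp-diff (shifted f g g≗σf e∈)))
               (satisfied? 0w f e) (satisfied? w g e))
      where
      open Potential P
      flip-∣ : ∀ {y x} → pos m ∣ x +ᶻ -ᶻ y → pos m ∣ y +ᶻ -ᶻ x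
      flip-∣ {y} {x} m∣ = subst (pos m ∣_) (neg x y) (∣m⇒∣-m m∣)
        where
        neg : ∀ x y → -ᶻ (x +ᶻ -ᶻ y) ≡ y +ᶻ -ᶻ x
        neg = solve-∀
      shifted : ∀ f g → (∀ v → g v ≡ rotate (pot v) (f v)) → ∀ {e} → e ∈ A →
        pos m ∣ discrepancy 0w f e +ᶻ -ᶻ discrepancy w g e
      shifted f g g≗σf {u , v} e∈ = subst (pos m ∣_) eq
        (∣m∣n⇒∣m+n (rotated u) (∣m⇒∣-m (rotated v)))
        where
        rotated : ∀ t → pos m ∣ residue (g t) +ᶻ -ᶻ (residue (f t) +ᶻ pot t)
        rotated t = subst (λ s → pos m ∣ residue s +ᶻ -ᶻ (residue (f t) +ᶻ pot t)) (sym (g≗σf t)) (rotate-∣ (pot t) (f t))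
        regroup : ∀ gu gv fu fv pu c →
          (gu +ᶻ -ᶻ (fu +ᶻ pu)) +ᶻ -ᶻ (gv +ᶻ -ᶻ (fv +ᶻ (pu +ᶻ c))) ≡
          ((fv +ᶻ -ᶻ fu) +ᶻ -ᶻ 0ℤ) +ᶻ -ᶻ ((gv +ᶻ -ᶻ gu) +ᶻ -ᶻ c)
        regroup = solve-∀
        eq : _ ≡ discrepancy 0w f (u , v) +ᶻ -ᶻ discrepancy w g (u , v)
        eq = trans
          (cong (λ t → (residue (g u) +ᶻ -ᶻ (residue (f u) +ᶻ pot u)) +ᶻ -ᶻ (residue (g v) +ᶻ -ᶻ (residue (f v) +ᶻ t)))
                (pot-edge (subst (_∈ A) (sym (undirected-< (All.lookup A< e∈))) e∈)))
          (regroup (residue (g u)) (residue (g v)) (residue (f u)) (residue (f v)) (pot u) (w u v))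

    module _ (w≤1 : ∀ x y → ∣ w x y ∣ ≤ 1) (n<m : n < m) where

      walkSum-bound : ∀ x ys → ∣ walkSum w x ys ∣ ≤ length ys
      walkSum-bound x []       = z≤n
      walkSum-bound x (y ∷ ys) = ℕ.≤-trans (ℤ.∣i+j∣≤∣i∣+∣j∣ (w x y) _) (ℕ.+-mono-≤ (w≤1 x y) (walkSum-bound y ys))

      circuitSum-bound : ∀ {E : V → V → Set} (C : Circuit E) → ∣ circuitSum w C ∣ < m
      circuitSum-bound C = ℕ.≤-<-trans
        (ℕ.≤-trans (ℤ.∣i+j∣≤∣i∣+∣j∣ (walkSum w (start C) (tail C)) _)
          (ℕ.≤-trans (ℕ.+-mono-≤ (walkSum-bound (start C) (tail C)) (w≤1 _ _))
            (ℕ.≤-trans (ℕ.≤-reflexive (ℕ.+-comm _ 1)) (unique-length≤ _ (unique C)))))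
        n<m

      -- A solution would make `m` divide the circuit sum, a nonzero integer of absolute value at
      -- most `n < m`.
      F-unbalanced : ∀ {A} (C : Circuit (Joined A)) → circuitSum w C ≢ 0ℤ → F w A [] ≡ 0
      F-unbalanced {A} C ≢0 = sumFuns-zero n m none
        where
        none : ∀ f → b2n (mixed w A [] f) ≡ 0
        none f with all (satisfies w f) A in sat
        ... | false = refl
        ... | true  = contradiction
          (small-multiple (circuit-satisfied w-anti A f sat C) (circuitSum-bound C)) ≢0

  -- Stands in for a bound on the number of components: every vertex of `S` costs a factor `m`.
  -- Allowing `r` below the size of `S` lets one exponent serve circuits of different lengths.
  F-determined : ∀ A (S : List V) → Unique S → ∀ r → r ≤ length S →
    (∀ f g → all (satisfies 0w f) A ≡ true → all (satisfies 0w g) A ≡ true →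
      (∀ v → v ∉ S → f v ≡ g v) → ∀ v → f v ≡ g v) →
    F 0w A [] ≤ m ^ (n ∸ r)
  F-determined A S uniq r r≤ det = ℕ.≤-trans
    (sumFuns-≤ n m _ (member S) (λ f → b2n≤1 (mixed 0w A [] f))
      (λ f g p q agree → det f g (nonzero f p) (nonzero g q) λ v v∉ → agree v (dec-false (v ∈? S) v∉)))
    (ℕ.≤-trans (ℕ.≤-reflexive (cong (m ^_) (#outside≡ S uniq))) (ℕ.^-monoʳ-≤ m (ℕ.∸-monoʳ-≤ n r≤)))
    where
    nonzero : ∀ f → b2n (mixed 0w A [] f) ≢ 0 → all (satisfies 0w f) A ≡ true
    nonzero f ≢0 with all (satisfies 0w f) A
    ... | true  = refl
    ... | false = contradiction refl ≢0

  agree-on-circuit : ∀ A (C : Circuit (Joined A)) f g → all (satisfies 0w f) A ≡ true → all (satisfies 0w g) A ≡ true →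
    f (start C) ≡ g (start C) → ∀ {v} → v ∈ vertices C → f v ≡ g v
  agree-on-circuit A C f g p q eq v∈ = trans (All.lookup (walk-constant A f p (walk C)) v∈)
    (trans eq (sym (All.lookup (walk-constant A g q (walk C)) v∈)))

  -- A plain solution is constant on the circuit, so the colour at `start C` fixes those on
  -- `tail C`, and there are at least `r` of them.
  F-circuit-≤ : ∀ A (C : Circuit (Joined A)) r → r < size C → F 0w A [] ≤ m ^ (n ∸ r)
  F-circuit-≤ A C r (s≤s r≤) with unique C
  ... | uniq@(_ ∷ uniq′) = F-determined A (tail C) uniq′ r r≤ det
    where
    det : ∀ f g → all (satisfies 0w f) A ≡ true → all (satisfies 0w g) A ≡ true →
      (∀ v → v ∉ tail C → f v ≡ g v) → ∀ v → f v ≡ g v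
    det f g p q agree v with v ∈? tail C
    ... | no v∉  = agree v v∉
    ... | yes v∈ = agree-on-circuit A C f g p q (agree (start C) (Unique[x∷xs]⇒x∉xs uniq)) (there v∈)

  -- Besides `tail C`, the vertex `a` off the circuit is determined too, since it shares the colour
  -- of `b`. This gains the one factor `m` that a circuit of length exactly `r` leaves over. The
  -- endpoint `b` may lie on the circuit or off it.
  F-pendant-≤ : ∀ A (C : Circuit (Joined A)) {a b} → Joined A a b → a ≢ b → a ∉ vertices C →
    F 0w A [] ≤ m ^ (n ∸ size C)
  F-pendant-≤ A C {a} {b} ab a≢b a∉ with unique C
  ... | uniq@(_ ∷ uniq′) = F-determined A (a ∷ tail C) (¬Any⇒All¬ _ (a∉ ∘ there) ∷ uniq′) (size C) ℕ.≤-refl det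
    where
    module _ (f g : V → Fin m) (p : all (satisfies 0w f) A ≡ true) (q : all (satisfies 0w g) A ≡ true)
             (agree : ∀ v → v ∉ a ∷ tail C → f v ≡ g v) where
      others : ∀ v → v ≢ a → f v ≡ g v
      others v v≢a with v ∈? tail C
      ... | no v∉  = agree v λ { (here eq) → v≢a eq ; (there v∈) → v∉ v∈ }
      ... | yes v∈ = agree-on-circuit A C f g p q (agree (start C)
              λ { (here eq) → a∉ (here (sym eq)) ; (there s∈) → Unique[x∷xs]⇒x∉xs uniq s∈ }) (there v∈)
      det : ∀ v → f v ≡ g v
      det v with v Fin.≟ a
      ... | no v≢a   = others v v≢a
      ... | yes refl = trans (joined-constant A f p ab) (trans (others b (a≢b ∘ sym)) (sym (joined-constant A g q ab)))

  -- Any colours off `tail C` extend to a solution by giving the tail the colour of `start C`,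
  -- because every edge of `A` has both ends on the circuit.
  F-circuit-≥ : ∀ {E : V → V → Set} {A} (C : Circuit E) →
    (∀ {u v} → (u , v) ∈ A → u ∈ vertices C × v ∈ vertices C) → m * m ^ (n ∸ size C) ≤ F 0w A []
  F-circuit-≥ {A = A} C A⊆ with unique C
  ... | uniq@(_ ∷ uniq′) = subst (_≤ F 0w A []) (cong (m ^_) exponent) (sumFuns-≥ n m _ (member (tail C)) collapse)
    where
    exponent : #outside (member (tail C)) ≡ suc (n ∸ size C)
    exponent = trans (#outside≡ (tail C) uniq′) (ℕ.+-∸-assoc 1 (unique-length≤ _ uniq))
    collapsed : (V → Fin m) → V → Fin m
    collapsed g v with v ∈? tail C
    ... | yes _ = g (start C)
    ... | no  _ = g v
    collapsed-vertices : ∀ g {v} → v ∈ vertices C → collapsed g v ≡ g (start C)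
    collapsed-vertices g {v} v∈ with v ∈? tail C
    ... | yes _ = refl
    collapsed-vertices g (here refl) | no _  = refl
    collapsed-vertices g (there v∈)  | no v∉ = contradiction v∈ v∉
    collapse : ∀ g → ∃ λ f → AgreeOff (member (tail C)) f g ×
      (∀ f′ → (∀ v → f′ v ≡ f v) → 1 ≤ b2n (mixed 0w A [] f′))
    collapse g = collapsed g , agree , satisfying
      where
      agree : AgreeOff (member (tail C)) (collapsed g) g
      agree v _ with v ∈? tail C
      ... | no _ = refl
      satisfying : ∀ f′ → (∀ v → f′ v ≡ collapsed g v) → 1 ≤ b2n (mixed 0w A [] f′)
      satisfying f′ f′≗ = subst (λ b → 1 ≤ b2n (b ∧ true)) (sym (all-true⁺ _ A λ { {u , v} e∈ →
        constant-satisfies f′ (trans (value (proj₁ (A⊆ e∈))) (sym (value (proj₂ (A⊆ e∈))))) })) ℕ.≤-refl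
        where
        value : ∀ {v} → v ∈ vertices C → f′ v ≡ g (start C)
        value v∈ = trans (f′≗ _) (collapsed-vertices g v∈)

-- Comparison of the plain and the twisted count

Walk-joined : ∀ {n} {E : Fin n → Fin n → Set} {A x ys z} → Walk E x ys z →
  (∀ {e} → e ∈ walkEdges x ys → e ∈ A) → Walk (Joined A) x ys z
Walk-joined stop     h = stop
Walk-joined (go e W) h = go (h (here refl)) (Walk-joined W (h ∘ there))

module Comparison {n : ℕ} {E : Fin n → Fin n → Set} (E-sym : ∀ {x y} → E x y → E y x)
  (w : Fin n → Fin n → ℤ) (w-anti : ∀ x y → w y x ≡ -ᶻ w x y) (w≤1 : ∀ x y → ∣ w x y ∣ ≤ 1)
  (r : ℕ) (r-even : evenᵇ r ≡ true) (short : ∀ (C : Circuit E) → size C < r → circuitSum w C ≡ 0ℤ)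
  (C₀ : Circuit E) (size-C₀ : size C₀ ≡ r) (sum-C₀ : circuitSum w C₀ ≢ 0ℤ)
  (m : ℕ) .{{_ : NonZero m}} (n<m : n < m) where

  open Expansion {n} m
  open Potentials w w-anti using (potential-or-circuit)
  open Chords {n} {E} E-sym w w-anti using (chord)
  open import Data.List.Membership.DecPropositional (≡-dec (Fin._≟_ {n}) (Fin._≟_ {n})) using () renaming (_∈?_ to _∈ᵉ?_)

  private V = Fin n

  -- The size of one error term, a factor `m` below the leading terms, which are at least `m * K`.
  K : ℕ
  K = m ^ (n ∸ r)

  Edge : V × V → Set
  Edge (u , v) = u Fin.< v × E u v

  weight : Bool → V → V → ℤ
  weight true  = 0w
  weight false = w

  joined-edge : ∀ {A} → All Edge A → ∀ {x y} → Joined A x y → E x y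
  joined-edge A-edges {x} {y} e with undirected-ends x y
  ... | inj₁ eq = proj₂ (All.lookup A-edges (subst (_∈ _) eq e))
  ... | inj₂ eq = E-sym (proj₂ (All.lookup A-edges (subst (_∈ _) eq e)))

  edge-joined : ∀ {A} → All Edge A → ∀ {x y} → (x , y) ∈ A → Joined A x y
  edge-joined A-edges e∈ = subst (_∈ _) (sym (undirected-< (proj₁ (All.lookup A-edges e∈)))) e∈

  -- A is the edge set of C, since by minimality of r the circuit C has no chord.
  circuit-length : ∀ {A} → Unique A → All Edge A → (C : Circuit (Joined A)) → circuitSum w C ≢ 0ℤ → size C ≡ r →
    All (λ (u , v) → u ∈ vertices C × v ∈ vertices C) A → length A ≡ r
  circuit-length {A} uniq A-edges C ≢0 size≡ spanned =
    trans (length-set uniq (circuitEdges-unique C) to (circuitEdges⊆ A C))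
      (trans (cong suc (length-walkEdges (start C) (tail C))) size≡)
    where
    to : ∀ {e} → e ∈ A → e ∈ circuitEdges C
    to {u , v} e∈ with All.lookup A-edges e∈ | All.lookup spanned e∈
    ... | u<v , uv | u∈ , v∈ = subst (_∈ circuitEdges C) (undirected-< u<v)
      (chord (Circuit-map (joined-edge A-edges) C) (λ C′ C′< → short C′ (subst (size C′ <_) size≡ C′<))
             ≢0 u∈ v∈ (Fin.<⇒≢ u<v) uv)

  -- A circuit longer than `r` already gives the bound. At length `r` parity decides: were all edges
  -- of `A` spanned by the circuit, `A` would be its edge set and have even size. So some edge has
  -- an endpoint off the circuit, and that endpoint is determined as well.
  odd-unbalanced-≤ : ∀ {A} → Unique A → All Edge A → evenᵇ (length A) ≡ false →
    (C : Circuit (Joined A)) → circuitSum w C ≢ 0ℤ → F 0w A [] ≤ K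
  odd-unbalanced-≤ {A} uniq A-edges odd C ≢0 with ℕ.<-cmp (size C) r
  ... | tri< C< _ _ = contradiction (short (Circuit-map (joined-edge A-edges) C) C<) ≢0
  ... | tri> _ _ C> = F-circuit-≤ A C r C>
  ... | tri≈ _ size≡ _ with All.all? (λ (u , v) → (u ∈? vertices C) ×-dec (v ∈? vertices C)) A
  ...   | yes spanned with () ← trans (sym odd) (trans (cong evenᵇ (circuit-length uniq A-edges C ≢0 size≡ spanned)) r-even)
  ...   | no ¬spanned with (u , v) , e∈ , outside ← find (¬All⇒Any¬ (λ (u , v) → (u ∈? vertices C) ×-dec (v ∈? vertices C)) A ¬spanned)
                      with u≢v ← Fin.<⇒≢ (proj₁ (All.lookup A-edges e∈)) | u ∈? vertices C
  ...     | no u∉  = subst (λ s → F 0w A [] ≤ m ^ (n ∸ s)) size≡ (F-pendant-≤ A C (edge-joined A-edges e∈) u≢v u∉)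
  ...     | yes u∈ = subst (λ s → F 0w A [] ≤ m ^ (n ∸ s)) size≡
    (F-pendant-≤ A C (Joined-sym A (edge-joined A-edges e∈)) (u≢v ∘ sym) (λ v∈ → outside (u∈ , v∈)))

  -- With b the parity of |A|, this bounds (−1)^|A| (plain − twisted) from below by p − c.
  Gap : Bool → List (V × V) → List (V × V) → ℕ → ℕ → Set
  Gap b A R p c = F (weight (not b)) A R + p ≤ F (weight b) A R + c

  -- By `F-split` the count for `e ∷ R` is the count for `R` less the count with `e` imposed.
  -- Imposing `e` flips the parity, which absorbs the minus sign, so both gains and both errors add
  -- up. Subtraction is avoided by adding `y + y′` to both sides.
  gap-split : ∀ b A e R {p q c d} → Gap b A R p c → Gap (not b) (e ∷ A) R q d → Gap b A (e ∷ R) (p + q) (c + d)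
  gap-split b A e R {p} {q} {c} {d} g₁ g₂ = ℕ.+-cancelʳ-≤ (y + y′) _ _ (begin
    (x + (p + q)) + (y + y′)     ≡⟨ left x y y′ p q ⟩
    ((x + y) + p) + (y′ + q)     ≤⟨ ℕ.+-mono-≤ g₁′ (g₂′ b g₂) ⟩
    ((x′ + y′) + c) + (y + d)    ≡⟨ right x′ y y′ c d ⟩
    (x′ + (c + d)) + (y + y′)    ∎)
    where
    open ℕ.≤-Reasoning
    x  = F (weight (not b)) A (e ∷ R)
    x′ = F (weight b) A (e ∷ R)
    y  = F (weight (not b)) (e ∷ A) R
    y′ = F (weight b) (e ∷ A) R
    g₁′ : (x + y) + p ≤ (x′ + y′) + c
    g₁′ = subst₂ (λ s t → s + p ≤ t + c) (sym (F-split (weight (not b)) A e R)) (sym (F-split (weight b) A e R)) g₁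
    g₂′ : ∀ b → Gap (not b) (e ∷ A) R q d → F (weight b) (e ∷ A) R + q ≤ F (weight (not b)) (e ∷ A) R + d
    g₂′ true  g = g
    g₂′ false g = g
    left : ∀ x y y′ p q → (x + (p + q)) + (y + y′) ≡ ((x + y) + p) + (y′ + q)
    left = ℕ-Solver.solve-∀
    right : ∀ x′ y y′ c d → ((x′ + y′) + c) + (y + d) ≡ (x′ + (c + d)) + (y + y′)
    right = ℕ-Solver.solve-∀

  -- With a potential the two counts agree. Otherwise the twisted count is zero, so an even `A`
  -- loses nothing and an odd one loses its plain count, at most `K`.
  gap-leaf : ∀ A → Unique A → All Edge A → Gap (evenᵇ (length A)) A [] 0 K
  gap-leaf A uniq A-edges with potential-or-circuit A (All.map proj₁ A-edges)
  ... | inj₁ P = ℕ.+-mono-≤ {y = F (weight (evenᵇ (length A))) A []} (balanced (evenᵇ (length A))) z≤n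
    where
    balanced : ∀ b → F (weight (not b)) A [] ≤ F (weight b) A []
    balanced true  = ℕ.≤-reflexive (sym (F-gauge w w-anti (All.map proj₁ A-edges) P))
    balanced false = ℕ.≤-reflexive (F-gauge w w-anti (All.map proj₁ A-edges) P)
  ... | inj₂ (C , ≢0) with evenᵇ (length A) in parity
  ...   | true  = subst (λ t → t + 0 ≤ F 0w A [] + K) (sym (F-unbalanced w w-anti w≤1 n<m C ≢0)) z≤n
  ...   | false = subst (_≤ F w A [] + K) (sym (ℕ.+-identityʳ _))
                    (ℕ.≤-trans (odd-unbalanced-≤ uniq A-edges parity C ≢0) (ℕ.m≤n+m K _))

  -- The source of the strict inequality: here `A` is the edge set of `C₀`, of even size `r`, with
  -- no twisted and at least `m * K` plain solutions.
  gap-leaf-C₀ : ∀ A → Unique A → All Edge A → (∀ {e} → e ∈ A → e ∈ circuitEdges C₀) →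
    (∀ {e} → e ∈ circuitEdges C₀ → e ∈ A) → Gap (evenᵇ (length A)) A [] (m * K) K
  gap-leaf-C₀ A uniq A-edges to from = subst (λ b → Gap b A [] (m * K) K) (sym (trans (cong evenᵇ |A|) r-even))
    (subst (λ t → t + m * K ≤ F 0w A [] + K) (sym (F-unbalanced w w-anti w≤1 n<m C sum-C₀))
      (ℕ.≤-trans (subst (λ s → m * m ^ (n ∸ s) ≤ F 0w A []) size-C₀ (F-circuit-≥ C₀ spanned)) (ℕ.m≤m+n _ K)))
    where
    |A| : length A ≡ r
    |A| = trans (length-set uniq (circuitEdges-unique C₀) to from)
            (trans (cong suc (length-walkEdges (start C₀) (tail C₀))) size-C₀)
    C : Circuit (Joined A)
    C = circuit (Walk-joined (walk C₀) (from ∘ there)) (from (here refl)) (unique C₀) (long C₀)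
    spanned : ∀ {u v} → (u , v) ∈ A → u ∈ vertices C₀ × v ∈ vertices C₀
    spanned {u} {v} e∈ = circuitEdges-ends C₀
      (subst (_∈ circuitEdges C₀) (sym (undirected-< (proj₁ (All.lookup A-edges e∈)))) (to e∈))

  -- Invariant of the recursion, with `A` imposed and `R` pending. It keeps every leaf free of
  -- duplicates, so that `length A` is the size of an edge set.
  record Fresh (A R : List (V × V)) : Set where
    constructor fresh
    field
      A-unique : Unique A
      A-edges  : All Edge A
      R-unique : Unique R
      R-edges  : All Edge R
      apart    : All (_∉ A) R

  fresh-skip : ∀ {A e R} → Fresh A (e ∷ R) → Fresh A R
  fresh-skip (fresh uA vA (_ ∷ uR) (_ ∷ vR) (_ ∷ ap)) = fresh uA vA uR vR ap

  fresh-take : ∀ {A e R} → Fresh A (e ∷ R) → Fresh (e ∷ A) R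
  fresh-take (fresh uA vA (e∉R ∷ uR) (ve ∷ vR) (e∉A ∷ ap)) = fresh (¬Any⇒All¬ _ e∉A ∷ uA) (ve ∷ vA) uR vR
    (All.zipWith (λ { (e≢x , x∉) (here eq) → e≢x (sym eq) ; (e≢x , x∉) (there x∈) → x∉ x∈ }) (e∉R , ap))

  double : ∀ k → 2 ^ k * K + 2 ^ k * K ≡ 2 ^ suc k * K
  double k = distribute (2 ^ k) K
    where
    distribute : ∀ a b → a * b + a * b ≡ (a + (a + 0)) * b
    distribute = ℕ-Solver.solve-∀

  -- The recursion has `2 ^ length R` leaves, each with error `K`.
  gap-any : ∀ R A → Fresh A R → Gap (evenᵇ (length A)) A R 0 (2 ^ length R * K)
  gap-any [] A f = subst (Gap (evenᵇ (length A)) A [] 0) (sym (ℕ.+-identityʳ K)) (gap-leaf A (Fresh.A-unique f) (Fresh.A-edges f))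
  gap-any (e ∷ R) A f = subst (Gap (evenᵇ (length A)) A (e ∷ R) 0) (double (length R))
    (gap-split (evenᵇ (length A)) A e R (gap-any R A (fresh-skip f)) (gap-any R (e ∷ A) (fresh-take f)))

  -- Follows the one branch that imposes exactly the edges of `C₀`; the sibling at each split is
  -- estimated by `gap-any`. The branch is kept by the inclusions of `A` in the edges of `C₀` and of
  -- these in `A` together with `R`.
  gap-C₀ : ∀ R A → Fresh A R → (∀ {e} → e ∈ A → e ∈ circuitEdges C₀) →
    (∀ {e} → e ∈ circuitEdges C₀ → e ∈ A ⊎ e ∈ R) → Gap (evenᵇ (length A)) A R (m * K) (2 ^ length R * K)
  gap-C₀ [] A f to from = subst (Gap (evenᵇ (length A)) A [] (m * K)) (sym (ℕ.+-identityʳ K))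
    (gap-leaf-C₀ A (Fresh.A-unique f) (Fresh.A-edges f) to (λ e∈ → [ id , (λ ()) ]′ (from e∈)))
  gap-C₀ (e ∷ R) A f to from with e ∈ᵉ? circuitEdges C₀
  ... | yes e∈ = subst (Gap (evenᵇ (length A)) A (e ∷ R) (m * K)) (double (length R))
    (gap-split (evenᵇ (length A)) A e R (gap-any R A (fresh-skip f))
      (gap-C₀ R (e ∷ A) (fresh-take f) (λ { (here refl) → e∈ ; (there x∈) → to x∈ }) from′))
    where
    from′ : ∀ {x} → x ∈ circuitEdges C₀ → x ∈ e ∷ A ⊎ x ∈ R
    from′ x∈ with from x∈
    ... | inj₁ x∈A          = inj₁ (there x∈A)
    ... | inj₂ (here refl)  = inj₁ (here refl)
    ... | inj₂ (there x∈R)  = inj₂ x∈R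
  ... | no e∉ = subst₂ (Gap (evenᵇ (length A)) A (e ∷ R)) (ℕ.+-identityʳ (m * K)) (double (length R))
    (gap-split (evenᵇ (length A)) A e R (gap-C₀ R A (fresh-skip f) to from′) (gap-any R (e ∷ A) (fresh-take f)))
    where
    from′ : ∀ {x} → x ∈ circuitEdges C₀ → x ∈ A ⊎ x ∈ R
    from′ x∈ with from x∈
    ... | inj₁ x∈A          = inj₁ x∈A
    ... | inj₂ (here refl)  = contradiction x∈ e∉
    ... | inj₂ (there x∈R)  = inj₂ x∈R

  -- From `A` empty, of even size, the recursion gains `m * K` against a total error of
  -- `2 ^ length R * K`, which is smaller because `K` is nonzero.
  twisted<plain : ∀ R → Unique R → All Edge R → (∀ {e} → e ∈ circuitEdges C₀ → e ∈ R) →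
    2 ^ length R < m → F w [] R < F 0w [] R
  twisted<plain R uniq R-edges C₀⊆ large = ℕ.+-cancelʳ-< (m * K) _ _
    (ℕ.≤-<-trans (gap-C₀ R [] (fresh [] [] uniq R-edges (All.tabulate λ _ ())) (λ ()) (inj₂ ∘ C₀⊆))
      (ℕ.+-monoʳ-< (F 0w [] R) (ℕ.*-monoˡ-< K {{ℕ.m^n≢0 m (n ∸ r)}} large)))

-- The twisted cover of an oriented graph

next-inject₁ : ∀ {k} (i : Fin k) → next (inject₁ i) ≡ suc i
next-inject₁ {k} i = Fin.toℕ-injective (begin
  toℕ (next (inject₁ i))           ≡⟨ Fin.toℕ-fromℕ< _ ⟩
  suc (toℕ (inject₁ i)) ℕ.% suc k  ≡⟨ cong (λ t → suc t ℕ.% suc k) (Fin.toℕ-inject₁ i) ⟩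
  suc (toℕ i) ℕ.% suc k            ≡⟨ m<n⇒m%n≡m (s≤s (Fin.toℕ<n i)) ⟩
  suc (toℕ i)                      ∎)
  where open ≡-Reasoning

next-fromℕ : ∀ k → next (fromℕ k) ≡ zero
next-fromℕ k = Fin.toℕ-injective (begin
  toℕ (next (fromℕ k))           ≡⟨ Fin.toℕ-fromℕ< _ ⟩
  suc (toℕ (fromℕ k)) ℕ.% suc k  ≡⟨ cong (λ t → suc t ℕ.% suc k) (Fin.toℕ-fromℕ k) ⟩
  suc k ℕ.% suc k                ≡⟨ n%n≡0 (suc k) ⟩
  0                              ∎)
  where open ≡-Reasoning

sumFin-last : ∀ k (h : Fin (suc k) → ℕ) → sumFin (suc k) h ≡ sumFin k (h ∘ inject₁) + h (fromℕ k)
sumFin-last zero    h = ℕ.+-identityʳ _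
sumFin-last (suc k) h = trans (cong (h zero +_) (sumFin-last k (h ∘ suc))) (sym (ℕ.+-assoc (h zero) _ _))

-- Passing between indexed cycles and walks

module _ {V : Set} where

  walkSum-tabulate : ∀ (g : V → V → ℕ) k (c : Fin (suc k) → V) →
    walkSum (λ u v → pos (g u v)) (c zero) (tabulate (c ∘ suc)) ≡ pos (sumFin k λ i → g (c (inject₁ i)) (c (suc i)))
  walkSum-tabulate g zero    c = refl
  walkSum-tabulate g (suc k) c = cong (pos (g (c zero) (c (suc zero))) +ᶻ_) (walkSum-tabulate g k (c ∘ suc))

  cyclic-sum : ∀ (g : V → V → ℕ) k (c : Fin (suc k) → V) →
    walkSum (λ u v → pos (g u v)) (c zero) (tabulate (c ∘ suc)) +ᶻ pos (g (c (fromℕ k)) (c zero)) ≡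
    pos (sumFin (suc k) λ i → g (c i) (c (next i)))
  cyclic-sum g k c = trans (cong (_+ᶻ pos (g (c (fromℕ k)) (c zero))) (walkSum-tabulate g k c)) (cong pos (begin
    sumFin k (λ i → g (c (inject₁ i)) (c (suc i))) + g (c (fromℕ k)) (c zero)
      ≡⟨ cong₂ (λ s t → s + g (c (fromℕ k)) (c t)) (sumFin-cong k λ i → cong (λ t → g (c (inject₁ i)) (c t)) (next-inject₁ i)) (next-fromℕ k) ⟨
    sumFin k (λ i → g (c (inject₁ i)) (c (next (inject₁ i)))) + g (c (fromℕ k)) (c (next (fromℕ k)))
      ≡⟨ sumFin-last k (λ i → g (c i) (c (next i))) ⟨
    sumFin (suc k) (λ i → g (c i) (c (next i)))
      ∎))
    where open ≡-Reasoning

  Walk-tabulate : ∀ {E : V → V → Set} k (c : Fin (suc k) → V) → (∀ i → E (c (inject₁ i)) (c (suc i))) →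
    Walk E (c zero) (tabulate (c ∘ suc)) (c (fromℕ k))
  Walk-tabulate zero    c e = stop
  Walk-tabulate (suc k) c e = go (e zero) (Walk-tabulate k (c ∘ suc) (e ∘ suc))

  Walk-lookup : ∀ {E : V → V → Set} {x ys z} → Walk E x ys z →
    ∀ i → E (lookup (x ∷ ys) (inject₁ i)) (lookup (x ∷ ys) (suc i))
  Walk-lookup (go e W) zero    = e
  Walk-lookup (go e W) (suc i) = Walk-lookup W i

  lookup-last : ∀ {E : V → V → Set} {x ys z} → Walk E x ys z → lookup (x ∷ ys) (fromℕ (length ys)) ≡ z
  lookup-last stop     = refl
  lookup-last (go _ W) = lookup-last W

  lookup-injective : ∀ {xs : List V} → Unique xs → ∀ {i j} → lookup xs i ≡ lookup xs j → i ≡ j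
  lookup-injective {x ∷ xs} uniq     {zero}  {zero}  eq = refl
  lookup-injective {x ∷ xs} uniq     {zero}  {suc j} eq =
    contradiction (subst (_∈ xs) (sym eq) (∈-lookup j)) (Unique[x∷xs]⇒x∉xs uniq)
  lookup-injective {x ∷ xs} uniq     {suc i} {zero}  eq =
    contradiction (subst (_∈ xs) eq (∈-lookup i)) (Unique[x∷xs]⇒x∉xs uniq)
  lookup-injective {x ∷ xs} (_ ∷ uniq) {suc i} {suc j} eq = cong suc (lookup-injective uniq eq)

allFin-true⁻ : ∀ k {f : Fin k → Bool} → Defs.allFin k f ≡ true → ∀ i → f i ≡ true
allFin-true⁻ (suc k) {f} eq i with f zero in f0
allFin-true⁻ (suc k) {f} eq zero    | true = f0
allFin-true⁻ (suc k) {f} eq (suc i) | true = allFin-true⁻ k eq i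

allFin-true⁺ : ∀ k {f : Fin k → Bool} → (∀ i → f i ≡ true) → Defs.allFin k f ≡ true
allFin-true⁺ zero    h = refl
allFin-true⁺ (suc k) {f} h rewrite h zero = allFin-true⁺ k (h ∘ suc)

even⇒evenᵇ : ∀ {r} → Even r → evenᵇ r ≡ true
even⇒evenᵇ (k , refl) = even-double k

odd⇒evenᵇ : ∀ {r} → Odd r → evenᵇ r ≡ false
odd⇒evenᵇ (k , refl) = cong not (even-double k)

module Oriented (G : Graph) (Es : EdgeSet G) (o : Orientation G Es) where

  V : Set
  V = Fin (n G)

  E : V → V → Set
  E u v = adj G u v ≡ true

  E-sym : ∀ {u v} → E u v → E v u
  E-sym {u} {v} e = trans (adj-sym G v u) e

  forward total : V → V → ℕ
  forward u v = b2n (mem Es u v ∧ dir o u v)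
  total u v = b2n (mem Es u v)

  -- ±1 on the edges of Es, according to their orientation, and 0 elsewhere.
  w : V → V → ℤ
  w u v = (pos (forward u v) +ᶻ pos (forward u v)) +ᶻ -ᶻ pos (total u v)

  w-anti : ∀ u v → w v u ≡ -ᶻ w u v
  w-anti u v rewrite memSym Es v u with mem Es u v in uv
  ... | false = refl
  ... | true rewrite valid o u v uv with dir o v u
  ...   | true  = refl
  ...   | false = refl

  w≤1 : ∀ u v → ∣ w u v ∣ ≤ 1
  w≤1 u v with mem Es u v | dir o u v
  ... | false | _     = z≤n
  ... | true  | true  = s≤s z≤n
  ... | true  | false = s≤s z≤n

  walkSum-w : ∀ x ys → walkSum w x ys ≡
    (walkSum (λ u v → pos (forward u v)) x ys +ᶻ walkSum (λ u v → pos (forward u v)) x ys)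
      +ᶻ -ᶻ walkSum (λ u v → pos (total u v)) x ys
  walkSum-w x []       = refl
  walkSum-w x (y ∷ ys) = trans (cong (w x y +ᶻ_) (walkSum-w y ys)) 
    (regroup (pos (forward x y)) (pos (total x y)) (walkSum (λ u v → pos (forward u v)) y ys) (walkSum (λ u v → pos (total u v)) y ys))
    where
    regroup : ∀ a b s t → ((a +ᶻ a) +ᶻ -ᶻ b) +ᶻ ((s +ᶻ s) +ᶻ -ᶻ t) ≡ ((a +ᶻ s) +ᶻ (a +ᶻ s)) +ᶻ -ᶻ (b +ᶻ t)
    regroup = solve-∀

  -- The total shift around a cycle in terms of the counts used by `Balanced`.
  excess : Cycle G → ℤ
  excess C = (pos (countForward o C) +ᶻ pos (countForward o C)) +ᶻ -ᶻ pos (countIn Es C)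

  -- The left side is what `circuitSum w (toCircuit C)` unfolds to.
  cyclic-w : ∀ (C : Cycle G) → walkSum w (vtx C zero) (tabulate (vtx C ∘ suc)) +ᶻ w (vtx C (fromℕ _)) (vtx C zero) ≡ excess C
  cyclic-w C = begin
    walkSum w (c zero) (tabulate (c ∘ suc)) +ᶻ w l (c zero)              ≡⟨ cong (_+ᶻ w l (c zero)) (walkSum-w (c zero) (tabulate (c ∘ suc))) ⟩
    ((sf +ᶻ sf) +ᶻ -ᶻ st) +ᶻ w l (c zero)                                ≡⟨ regroup sf st (pos (forward l (c zero))) (pos (total l (c zero))) ⟩
    ((sf +ᶻ pos (forward l (c zero))) +ᶻ (sf +ᶻ pos (forward l (c zero)))) +ᶻ -ᶻ (st +ᶻ pos (total l (c zero)))
                                                                         ≡⟨ cong₂ (λ a b → (a +ᶻ a) +ᶻ -ᶻ b) (cyclic-sum forward _ c) (cyclic-sum total _ c) ⟩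
    excess C                                                             ∎
    where
    open ≡-Reasoning
    c = vtx C
    l = c (fromℕ _)
    sf = walkSum (λ u v → pos (forward u v)) (c zero) (tabulate (c ∘ suc))
    st = walkSum (λ u v → pos (total u v)) (c zero) (tabulate (c ∘ suc))
    regroup : ∀ s t a b → ((s +ᶻ s) +ᶻ -ᶻ t) +ᶻ ((a +ᶻ a) +ᶻ -ᶻ b) ≡ ((s +ᶻ a) +ᶻ (s +ᶻ a)) +ᶻ -ᶻ (t +ᶻ b)
    regroup = solve-∀

  balanced⇒excess≡0 : ∀ C → Balanced o C → excess C ≡ 0ℤ
  balanced⇒excess≡0 C (_ , eq) = trans (cong (λ t → pos t +ᶻ -ᶻ pos (countIn Es C)) eq) (ℤ.+-inverseʳ (pos (countIn Es C)))

  -- A zero excess would make `countIn Es C` twice the forward count, hence even.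
  odd⇒excess≢0 : ∀ C → Odd (countIn Es C) → excess C ≢ 0ℤ
  odd⇒excess≢0 C odd ≡0 with () ← trans (sym (odd⇒evenᵇ odd))
    (trans (cong evenᵇ (sym (ℤ.+-injective (ℤ.i-j≡0⇒i≡j (pos (countForward o C + countForward o C)) (pos (countIn Es C)) ≡0)))) (even-double (countForward o C)))

  toCircuit : Cycle G → Circuit E
  toCircuit C = circuit
    (Walk-tabulate _ c λ i → subst (λ j → E (c (inject₁ i)) (c j)) (next-inject₁ i) (edges C (inject₁ i)))
    (subst (λ j → E (c (fromℕ _)) (c j)) (next-fromℕ _) (edges C (fromℕ _)))
    (Unique.tabulate⁺ {f = c} (inj C))
    (s≤s (s≤s z≤n))
    where c = vtx C

  size-toCircuit : ∀ C → size (toCircuit C) ≡ cycLength C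
  size-toCircuit C = length-tabulate (vtx C)

  -- Carries balance of the short cycles over to circuits, for which both length and total shift
  -- must be preserved.
  fromCircuit : ∀ (C : Circuit E) → Σ (Cycle G) λ D → cycLength D ≡ size C × circuitSum w C ≡ excess D
  fromCircuit (circuit W@(go {x} {y₁} _ (go {y = y₂} {ys} {z} _ _)) zx uniq _) = D , refl ,
      trans (cong₂ (λ t s → walkSum w x t +ᶻ w s x) (sym (tabulate-lookup (y₁ ∷ y₂ ∷ ys))) (sym (lookup-last W))) (cyclic-w D)
    where
    c : Fin (3 + length ys) → V
    c = lookup (x ∷ y₁ ∷ y₂ ∷ ys)
    c-edges : ∀ i → adj G (c i) (c (next i)) ≡ true
    c-edges i with view i
    ... | ‵fromℕ = subst₂ E (sym (lookup-last W)) (cong c (sym (next-fromℕ _))) zx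
    ... | ‵inj₁ {i = j} _ = subst (λ t → E (c (inject₁ j)) (c t)) (sym (next-inject₁ j)) (Walk-lookup W j)
    D : Cycle G
    D = record { vtx = c ; inj = lookup-injective uniq ; edges = c-edges }
  fromCircuit (circuit (go _ stop) _ _ (s≤s ()))

  IsEdge : V × V → Set
  IsEdge (u , v) = u Fin.< v × E u v

  isEdge? : ∀ e → Dec (IsEdge e)
  isEdge? (u , v) = (u Fin.<? v) ×-dec (adj G u v Bool.≟ true)

  edgeList : List (V × V)
  edgeList = filter isEdge? (cartesianProduct (allFin (n G)) (allFin (n G)))

  edgeList-unique : Unique edgeList
  edgeList-unique = Unique.filter⁺ isEdge? (Unique.cartesianProduct⁺ (Unique.allFin⁺ (n G)) (Unique.allFin⁺ (n G)))

  ∈-edgeList⁺ : ∀ {e} → IsEdge e → e ∈ edgeList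
  ∈-edgeList⁺ p = ∈-filter⁺ isEdge? (∈-cartesianProduct⁺ (∈-allFin _) (∈-allFin _)) p

  ∈-edgeList⁻ : ∀ {e} → e ∈ edgeList → IsEdge e
  ∈-edgeList⁻ e∈ = proj₂ (∈-filter⁻ isEdge? {xs = cartesianProduct (allFin (n G)) (allFin (n G))} e∈)

  E⇒≢ : ∀ {u v} → E u v → u ≢ v
  E⇒≢ {u} e refl with () ← trans (sym e) (irrfl G u)

  joined-edgeList : ∀ {u v} → E u v → Joined edgeList u v
  joined-edgeList {u} {v} e with u Fin.<? v
  ... | yes u<v = ∈-edgeList⁺ (u<v , e)
  ... | no u≮v  = ∈-edgeList⁺ (Fin.≤∧≢⇒< (ℕ.≮⇒≥ u≮v) (E⇒≢ (E-sym e)) , E-sym e)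

  circuitEdges⊆edgeList : ∀ (C : Circuit E) {e} → e ∈ circuitEdges C → e ∈ edgeList
  circuitEdges⊆edgeList C = circuitEdges⊆ edgeList (Circuit-map joined-edgeList C)

  -- The twisted cover and its colourings

  module Twist (m : ℕ) .{{_ : NonZero m}} where

    open Residues m
    open Expansion {n G} m

    linked? : ∀ u i v j → Dec (pos m ∣ (residue j +ᶻ -ᶻ residue i) +ᶻ -ᶻ w u v)
    linked? u i v j = pos m ∣? ((residue j +ᶻ -ᶻ residue i) +ᶻ -ᶻ w u v)

    linked-sym : ∀ u i v j → pos m ∣ (residue j +ᶻ -ᶻ residue i) +ᶻ -ᶻ w u v →
      pos m ∣ (residue i +ᶻ -ᶻ residue j) +ᶻ -ᶻ w v u
    linked-sym u i v j m∣ = subst (pos m ∣_)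
      (trans (reverse (residue i) (residue j) (w u v))
             (cong (λ t → (residue i +ᶻ -ᶻ residue j) +ᶻ -ᶻ t) (sym (w-anti u v))))
      (∣m⇒∣-m m∣)
      where
      reverse : ∀ a b c → -ᶻ ((b +ᶻ -ᶻ a) +ᶻ -ᶻ c) ≡ (a +ᶻ -ᶻ b) +ᶻ -ᶻ (-ᶻ c)
      reverse = solve-∀

    twisted : Cover G m
    twisted = record
      { cross    = λ u i v j → adj G u v ∧ does (linked? u i v j)
      ; crossSym = λ u i v j → cong₂ _∧_ (adj-sym G u v)
                     (does-⇔ (mk⇔ (linked-sym u i v j) (linked-sym v j u i)) (linked? u i v j) (linked? v j u i))
      ; crossAdj = λ u i v j eq → ∧-trueˡ eq
      -- Both `j` and `j′` are congruent to `i` plus the shift of `uv`, so they coincide modulo `m`.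
      ; matching = λ u i v j j′ eq eq′ → residue-injective (subst (pos m ∣_)
                     (cancel (residue i) (residue j) (residue j′) (w u v))
                     (∣m∣n⇒∣m+n (does-true (linked? u i v j′) (∧-trueʳ (adj G u v) eq′))
                                (∣m⇒∣-m (does-true (linked? u i v j) (∧-trueʳ (adj G u v) eq)))))
      }
      where
      ∧-trueˡ : ∀ {a b} → a ∧ b ≡ true → a ≡ true
      ∧-trueˡ {true} _ = refl
      ∧-trueʳ : ∀ a {b} → a ∧ b ≡ true → b ≡ true
      ∧-trueʳ true eq = eq
      cancel : ∀ a b c s → ((c +ᶻ -ᶻ a) +ᶻ -ᶻ s) +ᶻ -ᶻ ((b +ᶻ -ᶻ a) +ᶻ -ᶻ s) ≡ c +ᶻ -ᶻ b
      cancel = solve-∀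

    -- The endpoints of an edge of `G` differ, so the clique part of `Hadj` is false there and
    -- independence says that the congruence of the edge fails.
    PDP-twisted : PDPcover twisted ≤ F w [] edgeList
    PDP-twisted = subst (_≤ F w [] edgeList) (sym (countFuns≡sumFuns (n G) m _))
      (sumFuns-mono (n G) m λ f → b2n-mono (implies f))
      where
      unlinked : ∀ {a b c d} → a ≡ false → c ≡ true → a ∨ not ((a ∧ b) ∨ (c ∧ d)) ≡ true → not d ≡ true
      unlinked refl refl eq = eq
      implies : ∀ f → isHColoring twisted f ≡ true → mixed w [] edgeList f ≡ true
      implies f eq = all-true⁺ _ edgeList λ { {u , v} e∈ →
        let u<v , e = ∈-edgeList⁻ e∈ in
        unlinked {b = not ⌊ f u Fin.≟ f v ⌋} (⌊⌋-false (u Fin.≟ v) (Fin.<⇒≢ u<v)) e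
          (allFin-true⁻ (n G) (allFin-true⁻ (n G) eq u) v) }
        where
        ⌊⌋-false : ∀ {A : Set} (A? : Dec A) → ¬ A → ⌊ A? ⌋ ≡ false
        ⌊⌋-false (yes a) ¬a = contradiction a ¬a
        ⌊⌋-false (no _)  _  = refl

    P-plain : F 0w [] edgeList ≤ P G m
    P-plain = subst (F 0w [] edgeList ≤_) (sym (countFuns≡sumFuns (n G) m _))
      (sumFuns-mono (n G) m λ f → b2n-mono (implies f))
      where
      implies : ∀ f → mixed 0w [] edgeList f ≡ true → properB G m f ≡ true
      implies f eq = allFin-true⁺ (n G) λ u → allFin-true⁺ (n G) λ v → proper u v
        where
        differ : ∀ {u v} → u Fin.< v → E u v → f u ≢ f v
        differ {u} {v} u<v e fu≡fv with () ← trans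
          (sym (all-true⁻ (not ∘ satisfies 0w f) edgeList eq (∈-edgeList⁺ (u<v , e))))
          (cong not (constant-satisfies f fu≡fv))
        proper : ∀ u v → not (adj G u v ∧ ⌊ f u Fin.≟ f v ⌋) ≡ true
        proper u v with adj G u v in e | f u Fin.≟ f v
        ... | false | _     = refl
        ... | true  | no _  = refl
        ... | true  | yes p with u Fin.<? v
        ...   | yes u<v = contradiction p (differ u<v e)
        ...   | no u≮v  = contradiction (sym p) (differ (Fin.≤∧≢⇒< (ℕ.≮⇒≥ u≮v) (E⇒≢ (E-sym e))) (E-sym e))

theorem1p4 : (G : Graph) → Connected G → (Es : EdgeSet G) → (r₀ : ℕ)
    → GirthIs G Es r₀ → Even r₀
    → Σ (Orientation G Es) (λ o → ∀ (C : Cycle G) → cycLength C < r₀ → Balanced o C)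
    → InDPless G
-- The threshold exceeds `n G`, so that nonzero circuit sums stay nonzero modulo `m`, and the number
-- of edge subsets, so that `m * K` outweighs all the errors.
theorem1p4 G _ Es r₀ ((C₀ , odd , length-C₀) , _) r₀-evenᵇ (o , balanced) = suc (n G + 2 ^ length edgeList) , bound
  where
  open Oriented G Es o
  short : ∀ (C : Circuit E) → size C < r₀ → circuitSum w C ≡ 0ℤ
  short C C< with D , size≡ , sum≡ ← fromCircuit C =
    trans sum≡ (balanced⇒excess≡0 D (balanced D (subst (_< r₀) (sym size≡) C<)))
  bound : ∀ m → suc (n G + 2 ^ length edgeList) ≤ m → ∀ p → PDPIs G m p → p < P G m
  bound m@(suc _) M≤m p (_ , minimal) = begin-strict
    p                 ≤⟨ minimal twisted ⟩
    PDPcover twisted  ≤⟨ PDP-twisted ⟩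
    F w [] edgeList   <⟨ twisted<plain edgeList edgeList-unique (All.tabulate ∈-edgeList⁻)
                           (circuitEdges⊆edgeList (toCircuit C₀)) (ℕ.≤-<-trans (ℕ.m≤n+m _ (n G)) M≤m) ⟩
    F 0w [] edgeList  ≤⟨ P-plain ⟩
    P G m             ∎
    where
    open ℕ.≤-Reasoning
    open Twist m
    open Expansion {n G} m
    open Comparison E-sym w w-anti w≤1 r₀ (even⇒evenᵇ r₀-evenᵇ) short
      (toCircuit C₀) (trans (size-toCircuit C₀) length-C₀) (odd⇒excess≢0 C₀ odd ∘ trans (sym (cyclic-w C₀)))
      m (ℕ.≤-<-trans (ℕ.m≤m+n (n G) _) M≤m)
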